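{- Let $\tau$ be a nontrivial type and let $\tau=\rho_1\rho_2\cdots\rho_t$ be its (unique) factorisation into irreducible types. Suppose that the block decomposition of $\rho_i$ has $b_i$ blocks for $i\in[t]$, and set $b^*=\max(b_1,\dots,b_t)$. Then, as $n\to\infty$, \[ \chi\bigl( G(n,\tau)\bigr)= \Theta\bigl(\log_{(b^*-2)}(n)\bigr)\,. \]
   Context: For finite sets $X,Y\subseteq\mathbb{Q}$ with $X\cup Y=\{z_1<z_2<\dots<z_\ell\}$, the order type $\tau(X,Y)$ is the sequence $(\tau_1,\dots,\tau_\ell)$ with $\tau_i=1$ if $z_i\in X\setminus Y$, $\tau_i=2$ if $z_i\in Y\setminus X$, and $\tau_i=3$ if $z_i\in X\cap Y$. A type of width $k$ and length $\ell$ is the order type of a pair $(X,Y)$ with $|X|=|Y|=k$ and $|X\cup Y|=\ell$; the empty sequence is the empty type. A type is trivial if all its entries equal $3$. Juxtaposition denotes concatenation of sequences. A nonempty type is irreducible if it cannot be written as the concatenation of two nonempty types; every nonempty type factors uniquely as a concatenation of irreducible types. For a finite sequence $B$ of ones, twos and threes, $\mathbf{1}(B)$ denotes the number of entries equal to $1$ or $3$, and $\mathbf{2}(B)$ the number of entries equal to $2$ or $3$. The trivial irreducible type $3$ has exactly one block. A nontrivial irreducible type starts with $1$ (primary) or $2$ (secondary). Block decomposition of a primary irreducible type $\rho$: the first block $B_1$ consists of all initial ones of $\rho$; once $B_i$ is constructed, $B_{i+1}$ consists of the next consecutive entries of $\rho$ such that $\mathbf{2}(B_{i+1})=\mathbf{1}(B_i)$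 and, subject to this, $B_{i+1}$ is as long as possible; one stops when all entries are placed, giving $\rho=B_1\cdots B_b$ with $b$ blocks. For a secondary irreducible type, interchange ones and twos, decompose, and interchange back (same number of blocks). For a nontrivial type $\tau$ of width $k$ and $n\ge k$, the type-graph $G(n,\tau)$ has vertex set $\binom{[n]}{k}$, with $X,Y$ adjacent iff $\tau(X,Y)=\tau$ or $\tau(Y,X)=\tau$. $\log_{(t)}$ denotes the $t$-fold iterated base-$2$ logarithm, with $\log_{(0)}(n)=n$. -}

module Defs where

open import Data.Nat using (ℕ; zero; suc; _+_; _*_; _∸_; _≤_; _⊔_)
open import Data.Nat.Logarithm using (⌊log₂_⌋)
open import Data.Fin using (Fin)
open import Data.Fin.Subset using (Subset; Side; inside; outside; ∣_∣)
open import Data.Vec using (Vec; []; _∷_)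
open import Data.List using (List; []; _∷_; _++_; map; foldr; concat)
open import Data.List.Relation.Unary.All using (All)
open import Data.List.Relation.Unary.Any using (Any)
open import Data.Product using (Σ; ∃; _×_; _,_)
open import Data.Sum using (_⊎_)
open import Relation.Binary.PropositionalEquality using (_≡_; _≢_)
open import Relation.Nullary using (¬_)

data Entry : Set where
  one two three : Entry

Seq : Set
Seq = List Entry

orderType : ∀ {n} → Subset n → Subset n → Seq
orderType []             []             = []
orderType (inside  ∷ xs) (inside  ∷ ys) = three ∷ orderType xs ys
orderType (inside  ∷ xs) (outside ∷ ys) = one   ∷ orderType xs ys
orderType (outside ∷ xs) (inside  ∷ ys) = two   ∷ orderType xs ys
orderType (outside ∷ xs) (outside ∷ ys) = orderType xs ys

ones : Seq → ℕ
ones []             = 0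
ones (one   ∷ b)    = suc (ones b)
ones (two   ∷ b)    = ones b
ones (three ∷ b)    = suc (ones b)

twos : Seq → ℕ
twos []             = 0
twos (one   ∷ b)    = twos b
twos (two   ∷ b)    = suc (twos b)
twos (three ∷ b)    = suc (twos b)

-- A type is the order type of a pair (X,Y) with |X| = |Y|.  (Finite subsets of ℚ
-- are order-isomorphic to subsets of [n], so we realise them inside some [n].)
IsType : Seq → Set
IsType τ = Σ ℕ λ n → Σ (Subset n) λ X → Σ (Subset n) λ Y →
             (∣ X ∣ ≡ ∣ Y ∣) × (orderType X Y ≡ τ)

-- The width of a type (= |X| for any realising pair).
width : Seq → ℕ
width = ones

Trivial : Seq → Set
Trivial τ = All (_≡ three) τ

Nontrivial : Seq → Set
Nontrivial τ = ¬ Trivial τ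

NonEmpty : Seq → Set
NonEmpty τ = τ ≢ []

Irreducible : Seq → Set
Irreducible ρ = IsType ρ × NonEmpty ρ ×
  (∀ σ₁ σ₂ → IsType σ₁ → IsType σ₂ → NonEmpty σ₁ → NonEmpty σ₂ → σ₁ ++ σ₂ ≢ ρ)

-- Block decomposition of a primary irreducible type, run as the greedy procedure
-- of the paper.  'inBlock cnt need next rest': cnt blocks have been started
-- (including the current one), the current block still needs 'need' more entries
-- counted by 𝟐 (entries 2 or 3), and 'next' is 𝟏 of the current block so far.
-- When need = 0 the current block is extended by further 1s (as long as possible);
-- an entry 2 or 3 then starts a new block B' with 𝟐(B') = next = 𝟏(current block).
-- (The degenerate case next = 0 cannot occur for irreducible types.)
inBlock : ℕ → ℕ → ℕ → Seq → ℕ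
inBlock cnt need       next []           = cnt
inBlock cnt need       next (one ∷ r)    = inBlock cnt need (suc next) r
inBlock cnt (suc need) next (two ∷ r)    = inBlock cnt need next r
inBlock cnt (suc need) next (three ∷ r)  = inBlock cnt need (suc next) r
inBlock cnt zero (suc m) (two ∷ r)       = inBlock (suc cnt) m 0 r
inBlock cnt zero (suc m) (three ∷ r)     = inBlock (suc cnt) m 1 r
inBlock cnt zero zero    (two ∷ r)       = suc cnt
inBlock cnt zero zero    (three ∷ r)     = suc cnt

-- First block: all initial ones (counted in k); then the second block must have 𝟐 = k.
firstBlock : ℕ → Seq → ℕ
firstBlock k (one ∷ r) = firstBlock (suc k) r
firstBlock k r         = inBlock 1 zero k r

primaryBlocks : Seq → ℕ
primaryBlocks ρ = firstBlock 0 ρ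

swap12 : Entry → Entry
swap12 one   = two
swap12 two   = one
swap12 three = three

numBlocks : Seq → ℕ
numBlocks (three ∷ []) = 1
numBlocks (two ∷ ρ)    = primaryBlocks (map swap12 (two ∷ ρ))
numBlocks ρ            = primaryBlocks ρ

maximum : List ℕ → ℕ
maximum = foldr _⊔_ 0

logIter : ℕ → ℕ → ℕ
logIter zero    n = n
logIter (suc t) n = ⌊log₂ logIter t n ⌋

Vertex : ℕ → ℕ → Set
Vertex n k = Σ (Subset n) λ X → ∣ X ∣ ≡ k

Adjacent : ∀ {n k} → Seq → Vertex n k → Vertex n k → Set
Adjacent τ (X , _) (Y , _) = (orderType X Y ≡ τ) ⊎ (orderType Y X ≡ τ)

Colourable : Seq → ℕ → ℕ → Set
Colourable τ n m = Σ (Vertex n (width τ) → Fin m) λ c →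
  ∀ u v → Adjacent τ u v → c u ≢ c v

{-# OPTIONS --safe #-}
module Submission where

-- Upper bound.  It suffices to colour a single factor with b* blocks.  Edges X → Y of a
-- primary irreducible type satisfy xⱼ < yⱼ and xⱼ₊₁ ≤ yⱼ, and b blocks give indices
-- i₀ ≤ i₁ ≤ … ≤ i_(b-2) with y at iₜ bounded by x at iₜ₊₁.  Let δ be the position of the highest
-- binary digit in which two numbers differ.  Depending on where the top digit splits X, the
-- numbers δ(xⱼ, x_last), in reverse order, or δ(x_first, xⱼ) again satisfy these conditions for
-- a chain of indices shorter by one, provided X and Y agree in a bounded amount of
-- information on coincidences among these numbers.  Thus one logarithm is gained per block,
-- down to two blocks, where x at i₀ itself is a proper colour.
--
-- Lower bound.  A primary irreducible type with b blocks is the type of a pair (X, X + K)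
-- with X in the first b - 1 cells of length K.  Moving the cells by an increasing map turns
-- this into a homomorphism from the shift graph of (b - 1)-subsets.  Concatenating such homomorphisms
-- for all factors gives one from the shift graph of (b* - 1)-subsets of [N] to G(n, τ), with N
-- linear in n, and shift graphs are bounded by the usual power set argument.

open import Defs
open import Data.Empty using (⊥)
open import Data.Fin using (Fin; zero; suc; toℕ; fromℕ<; inject≤; combine; funToFin; finToFun)
import Data.Fin as Fin
open import Data.Fin.Properties using (toℕ<n; toℕ-injective; toℕ-fromℕ<; fromℕ<-injective;
  inject≤-injective; combine-injectiveˡ; combine-injectiveʳ; finToFun-funToFin; any?; injective⇒≤)
open import Data.Fin.Subset using (Subset; inside; outside; ∣_∣)
open import Data.List using (List; []; _∷_; _++_; map; length; applyUpTo; concat)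
open import Data.List.Properties using (++-assoc; ++-identityʳ; length-++; map-++; map-∘; map-cong;
  map-cong-local; ∷-injectiveʳ; concat-++)
open import Data.List.Relation.Unary.All as All using (All; []; _∷_)
open import Data.List.Relation.Unary.All.Properties using (++⁺; ++⁻ˡ; ++⁻ʳ; map⁻)
open import Data.Nat
open import Data.Nat.DivMod
open import Data.Nat.Logarithm
open import Data.Nat.Properties
open import Data.Product using (Σ; ∃; _×_; _,_; proj₁; proj₂)
open import Data.Sum using (_⊎_; inj₁; inj₂)
open import Data.Unit using (⊤; tt)
open import Data.Vec using ([]; _∷_)
open import Function using (_∘_; id)
open import Relation.Binary.Definitions using (tri<; tri≈; tri>)
open import Relation.Binary.PropositionalEquality
open import Relation.Nullary using (¬_; Dec; yes; no; contradiction; _×-dec_)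

-- Iterated logarithms

⌊log₂[2^e*n]⌋ : ∀ e n .{{_ : NonZero n}} → ⌊log₂ (2 ^ e * n) ⌋ ≡ e + ⌊log₂ n ⌋
⌊log₂[2^e*n]⌋ zero    n = cong ⌊log₂_⌋ (*-identityˡ n)
⌊log₂[2^e*n]⌋ (suc e) n =
  let instance _ = m*n≢0 (2 ^ e) n {{m^n≢0 2 e}} in
  trans (cong ⌊log₂_⌋ (*-assoc 2 (2 ^ e) n))
  (trans (⌊log₂[2*b]⌋≡1+⌊log₂b⌋ (2 ^ e * n)) (cong suc (⌊log₂[2^e*n]⌋ e n)))

n<2^n : ∀ n → n < 2 ^ n
n<2^n zero    = s≤s z≤n
n<2^n (suc n) = +-mono-≤ (m^n>0 2 n) (≤-trans (n<2^n n) (≤-reflexive (sym (+-identityʳ _))))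

⌊log₂[e*n]⌋≤ : ∀ e n .{{_ : NonZero n}} → ⌊log₂ (e * n) ⌋ ≤ e + ⌊log₂ n ⌋
⌊log₂[e*n]⌋≤ e n = ≤-trans (⌊log₂⌋-mono-≤ (*-monoˡ-≤ n (<⇒≤ (n<2^n e))))
                           (≤-reflexive (⌊log₂[2^e*n]⌋ e n))

e+n≤[1+e]*n : ∀ e n .{{_ : NonZero n}} → e + n ≤ suc e * n
e+n≤[1+e]*n e n = ≤-trans (≤-reflexive (+-comm e n)) (+-monoʳ-≤ n (m≤m*n e n))

n<2^[1+⌊log₂n⌋] : ∀ n → n < 2 ^ suc ⌊log₂ n ⌋
n<2^[1+⌊log₂n⌋] n = ≰⇒> λ p → n≮n ⌊log₂ n ⌋
  (≤-trans (≤-reflexive (sym (⌊log₂[2^n]⌋≡n (suc ⌊log₂ n ⌋)))) (⌊log₂⌋-mono-≤ p))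

2^k≤n⇒k≤⌊log₂n⌋ : ∀ {k n} → 2 ^ k ≤ n → k ≤ ⌊log₂ n ⌋
2^k≤n⇒k≤⌊log₂n⌋ {k} p = ≤-trans (≤-reflexive (sym (⌊log₂[2^n]⌋≡n k))) (⌊log₂⌋-mono-≤ p)

n≤2^k⇒⌊log₂n⌋≤k : ∀ {k n} → n ≤ 2 ^ k → ⌊log₂ n ⌋ ≤ k
n≤2^k⇒⌊log₂n⌋≤k {k} p = ≤-trans (⌊log₂⌋-mono-≤ p) (≤-reflexive (⌊log₂[2^n]⌋≡n k))

-- `logIter` adds logarithms on the outside, while both estimates below peel off the innermost one.
logIter-⌊log₂⌋ : ∀ t n → logIter t ⌊log₂ n ⌋ ≡ logIter (suc t) n
logIter-⌊log₂⌋ zero    n = refl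
logIter-⌊log₂⌋ (suc t) n = cong ⌊log₂_⌋ (logIter-⌊log₂⌋ t n)

-- One logarithm turns the factor `e` into a summand, which the factor `suc e` absorbs once the
-- logarithm of `n′` is positive. Hence `e` varies in the induction.
logIter-multiple : ∀ t e → ∃ λ a → ∃ λ N → ∀ n n′ → N ≤ n′ → n ≤ e * n′ →
                   logIter t n ≤ a * logIter t n′
logIter-multiple zero    e = e , 0 , λ _ _ _ p → p
logIter-multiple (suc t) e =
  let a , N , h = logIter-multiple t (suc e) in
  -- The successor in the exponent keeps `⌊log₂ n′ ⌋` positive even when `N` is 0.
  a , 2 ^ suc N , λ n n′ N≤n′ n≤en′ →
    let big = 2^k≤n⇒k≤⌊log₂n⌋ {suc N} N≤n′
        instance _ = >-nonZero (≤-trans (m^n>0 2 (suc N)) N≤n′)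
                 _ = >-nonZero (≤-trans (s≤s z≤n) big)
    in subst₂ (λ u v → u ≤ a * v) (logIter-⌊log₂⌋ t n) (logIter-⌊log₂⌋ t n′)
       (h ⌊log₂ n ⌋ ⌊log₂ n′ ⌋ (≤-trans (n≤1+n N) big)
         (≤-trans (⌊log₂⌋-mono-≤ n≤en′)
         (≤-trans (⌊log₂[e*n]⌋≤ e n′) (e+n≤[1+e]*n e ⌊log₂ n′ ⌋))))

-- The colours used by `c` recursion steps on values below `n`, each step recording one of `S`
-- shapes. Digit positions of such values range from 0 to `1 + ⌊log₂ n ⌋`, hence the
-- `2 + ⌊log₂ n ⌋`.
paletteSize : ℕ → ℕ → ℕ → ℕ
paletteSize S zero    n = n
paletteSize S (suc c) n = S * paletteSize S c (2 + ⌊log₂ n ⌋)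

paletteSize-mono : ∀ S c {n n′} → n ≤ n′ → paletteSize S c n ≤ paletteSize S c n′
paletteSize-mono S zero    p = p
paletteSize-mono S (suc c) p =
  *-monoʳ-≤ S (paletteSize-mono S c (+-monoʳ-≤ 2 (⌊log₂⌋-mono-≤ p)))

-- The summand `e` collects the additive constants of the levels passed so far.
paletteSize-bound : ∀ S c e → ∃ λ b → ∃ λ N → ∀ n → N ≤ n →
                    paletteSize S c (e + n) ≤ b * logIter c n
paletteSize-bound S zero    e = suc e , 1 , λ n p → e+n≤[1+e]*n e n {{>-nonZero p}}
paletteSize-bound S (suc c) e =
  let b , N , h = paletteSize-bound S c (3 + e) in
  S * b , 2 ^ N , λ n p →
    let instance _ = >-nonZero (≤-trans (m^n>0 2 N) p) in
    begin
      S * paletteSize S c (2 + ⌊log₂ (e + n) ⌋)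
        ≤⟨ *-monoʳ-≤ S (paletteSize-mono S c (+-monoʳ-≤ 2
             (≤-trans (⌊log₂⌋-mono-≤ (e+n≤[1+e]*n e n)) (⌊log₂[e*n]⌋≤ (suc e) n)))) ⟩
      S * paletteSize S c (3 + e + ⌊log₂ n ⌋)
        ≤⟨ *-monoʳ-≤ S (h ⌊log₂ n ⌋ (2^k≤n⇒k≤⌊log₂n⌋ {N} p)) ⟩
      S * (b * logIter c ⌊log₂ n ⌋)
        ≡⟨ cong (λ u → S * (b * u)) (logIter-⌊log₂⌋ c n) ⟩
      S * (b * logIter (suc c) n)
        ≡⟨ *-assoc S b _ ⟨
      S * b * logIter (suc c) n ∎
  where open ≤-Reasoning

-- Highest differing digits

-- The position of the highest binary digit in which x and y differ, counted
-- from 1, with 0 meaning x = y; only the lowest m digits are inspected.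
δ : ℕ → ℕ → ℕ → ℕ
δ zero    x y = 0
δ (suc m) x y with x ≟ y
... | yes _ = 0
... | no  _ = suc (δ m ⌊ x /2⌋ ⌊ y /2⌋)

δ≤ : ∀ m x y → δ m x y ≤ m
δ≤ zero    x y = z≤n
δ≤ (suc m) x y with x ≟ y
... | yes _ = z≤n
... | no  _ = s≤s (δ≤ m _ _)

δ-refl : ∀ m x → δ m x x ≡ 0
δ-refl zero    x = refl
δ-refl (suc m) x with x ≟ x
... | yes _   = refl
... | no  x≢x = contradiction refl x≢x

δ-prefix : ∀ m {x y z} → x ≤ y → y ≤ z → δ m x y ≤ δ m x z
δ-prefix zero    p q = z≤n
δ-prefix (suc m) {x} {y} {z} p q with x ≟ y | x ≟ z
... | yes _   | _        = z≤n
... | no  x≢y | yes refl = contradiction (≤-antisym p q) x≢y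
... | no  _   | no  _    = s≤s (δ-prefix m (⌊n/2⌋-mono p) (⌊n/2⌋-mono q))

δ-suffix : ∀ m {x y z} → x ≤ y → y ≤ z → δ m y z ≤ δ m x z
δ-suffix zero    p q = z≤n
δ-suffix (suc m) {x} {y} {z} p q with y ≟ z | x ≟ z
... | yes _   | _        = z≤n
... | no  y≢z | yes refl = contradiction (≤-antisym q p) y≢z
... | no  _   | no  _    = s≤s (δ-suffix m (⌊n/2⌋-mono p) (⌊n/2⌋-mono q))

-- For numbers below `2 ^ m`: agreement in all digits from position `d` upwards is transitive.
δ-ultrametric : ∀ m x y z {d} → δ m x y < d → δ m y z < d → δ m x z < d
δ-ultrametric zero    x y z p q = p
δ-ultrametric (suc m) x y z p q with x ≟ y | y ≟ z | x ≟ z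
... | yes _    | _        | yes _   = ≤-trans (s≤s z≤n) p
... | no  _    | _        | yes _   = ≤-trans (s≤s z≤n) p
... | yes refl | yes refl | no  x≢x = contradiction refl x≢x
... | yes refl | no  _    | no  _   = q
... | no  _    | yes refl | no  _   = p
δ-ultrametric (suc m) x y z (s≤s p) (s≤s q) | no _ | no _ | no _ = s≤s (δ-ultrametric m _ _ _ p q)

⌊/2⌋<2^ : ∀ m {x} → x < 2 ^ suc m → ⌊ x /2⌋ < 2 ^ m
⌊/2⌋<2^ m {x} p = ≰⇒> λ q → <⇒≱ p (begin
  2 ^ suc m           ≤⟨ *-monoʳ-≤ 2 q ⟩
  2 * ⌊ x /2⌋         ≡⟨ cong (⌊ x /2⌋ +_) (+-identityʳ _) ⟩
  ⌊ x /2⌋ + ⌊ x /2⌋   ≤⟨ +-monoʳ-≤ ⌊ x /2⌋ (⌊n/2⌋≤⌈n/2⌉ x) ⟩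
  ⌊ x /2⌋ + ⌈ x /2⌉   ≡⟨ ⌊n/2⌋+⌈n/2⌉≡n x ⟩
  x ∎)
  where open ≤-Reasoning

δ≡0⇒≡ : ∀ m {x y} → x < 2 ^ m → y < 2 ^ m → δ m x y ≡ 0 → x ≡ y
δ≡0⇒≡ zero    p q _ = trans (n<1⇒n≡0 p) (sym (n<1⇒n≡0 q))
δ≡0⇒≡ (suc m) {x} {y} p q e with x ≟ y
... | yes x≡y = x≡y

⌊/2⌋-collision : ∀ {x y z} → x < y → y < z → ⌊ x /2⌋ < ⌊ z /2⌋
⌊/2⌋-collision {x} x<y y<z = ⌊n/2⌋-mono (≤-trans (s≤s x<y) y<z)

-- The highest differing digit is 0 in the smaller number and 1 in the larger one,
-- so y cannot carry both values.
δ-binary : ∀ m {x y z d} → x ≤ y → y ≤ z → z < 2 ^ m → 0 < d → δ m x y ≡ d → δ m y z ≡ d → ⊥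
δ-binary zero    p q b 0<d refl _ = contradiction 0<d λ ()
δ-binary (suc m) {x} {y} {z} {d} p q b 0<d e f with x ≟ y | y ≟ z
... | yes _   | _       = contradiction 0<d (λ 0<d → n≮n 0 (subst (0 <_) (sym e) 0<d))
... | no _    | yes _   = contradiction 0<d (λ 0<d → n≮n 0 (subst (0 <_) (sym f) 0<d))
... | no x≢y  | no y≢z
  with suc d′ ← d
  with d′
... | suc d″ = δ-binary m (⌊n/2⌋-mono p) (⌊n/2⌋-mono q) (⌊/2⌋<2^ m b) (s≤s z≤n) (suc-injective e) (suc-injective f)
-- All three halves are equal here, but `x < y < z` puts `z` at least 2 above `x`.
... | zero   = <⇒≢ (⌊/2⌋-collision (≤∧≢⇒< p x≢y) (≤∧≢⇒< q y≢z))
  (trans (δ≡0⇒≡ m (⌊/2⌋<2^ m (≤-<-trans (≤-trans p q) b)) (⌊/2⌋<2^ m (≤-<-trans q b)) (suc-injective e))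
         (δ≡0⇒≡ m (⌊/2⌋<2^ m (≤-<-trans q b)) (⌊/2⌋<2^ m b) (suc-injective f)))

-- Coincidence patterns as a bounded number of colours

bit : {P : Set} → Dec P → Fin 2
bit (yes _) = zero
bit (no  _) = suc zero

bit-transfer : {P Q : Set} (p : Dec P) (q : Dec Q) → bit p ≡ bit q → P → Q
bit-transfer _      (yes q) _ _ = q
bit-transfer (no ¬p) (no _) _ p = contradiction p ¬p

funToFin-injective : ∀ {m n} {f g : Fin m → Fin n} → funToFin f ≡ funToFin g → ∀ j → f j ≡ g j
funToFin-injective {m} {n} {f} {g} e j = trans (sym (finToFun-funToFin f j))
  (trans (cong (λ c → finToFun {n} {m} c j) e) (finToFun-funToFin g j))

patternCode : ∀ K → ((j : ℕ) → Fin 2) → Fin (2 ^ K)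
patternCode K f = funToFin {K} (λ j → f (toℕ j))

patternCode-injective : ∀ K f g → patternCode K f ≡ patternCode K g → ∀ {j} → j < K → f j ≡ g j
patternCode-injective K f g e {j} j<K = begin
  f j                   ≡⟨ cong f (toℕ-fromℕ< j<K) ⟨
  f (toℕ (fromℕ< j<K))  ≡⟨ funToFin-injective e (fromℕ< j<K) ⟩
  g (toℕ (fromℕ< j<K))  ≡⟨ cong g (toℕ-fromℕ< j<K) ⟩
  g j ∎
  where open ≡-Reasoning

module _ (m K a b k : ℕ) where

  -- For nondecreasing `x` below `2 ^ m` and `a ≤ b ≤ k`, the highest digit in which `x a` and `x k`
  -- differ is 0 up to some index and 1 from then on; the split is early when `x b` already has the
  -- 1.
  EarlySplit : (ℕ → ℕ) → Set
  EarlySplit x = δ m (x b) (x k) < δ m (x a) (x k)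

  earlySplit? : ∀ x → Dec (EarlySplit x)
  earlySplit? x = δ m (x b) (x k) <? δ m (x a) (x k)

  ToLastEq FromFirstEq : (ℕ → ℕ) → ℕ → Set
  ToLastEq    x j = δ m (x j) (x k) ≡ δ m (x (suc j)) (x k)
  FromFirstEq x j = δ m (x a) (x j) ≡ δ m (x a) (x (suc j))

  toLastEq? : ∀ x j → Dec (ToLastEq x j)
  toLastEq? x j = _ ≟ _

  fromFirstEq? : ∀ x j → Dec (FromFirstEq x j)
  fromFirstEq? x j = _ ≟ _

  toLastBits fromFirstBits : (ℕ → ℕ) → ℕ → Fin 2
  toLastBits    x j = bit (toLastEq? x j)
  fromFirstBits x j = bit (fromFirstEq? x j)

  shape : (ℕ → ℕ) → Fin (2 * (2 ^ K * 2 ^ K))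
  shape x = combine (bit (earlySplit? x))
    (combine (patternCode K (toLastBits x)) (patternCode K (fromFirstBits x)))

  record ShapeTransfer (x y : ℕ → ℕ) : Set where
    field
      early : EarlySplit x → EarlySplit y
      toLast : ∀ {j} → j < K → ToLastEq x j → ToLastEq y j
      fromFirst : ∀ {j} → j < K → FromFirstEq x j → FromFirstEq y j

  shape-transfer : ∀ x y → shape x ≡ shape y → ShapeTransfer x y
  shape-transfer x y e = record
    { early = bit-transfer (earlySplit? x) (earlySplit? y) (combine-injectiveˡ _ _ _ _ e)
    ; toLast = λ j<K → bit-transfer (toLastEq? x _) (toLastEq? y _)
        (patternCode-injective K (toLastBits x) (toLastBits y) (combine-injectiveˡ _ _ _ _ e′) j<K)
    ; fromFirst = λ j<K → bit-transfer (fromFirstEq? x _) (fromFirstEq? y _)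
        (patternCode-injective K (fromFirstBits x) (fromFirstBits y)
          (combine-injectiveʳ (patternCode K (toLastBits x)) _ (patternCode K (toLastBits y)) _ e′) j<K)
    }
    where
      e′ = combine-injectiveʳ (bit (earlySplit? x)) _ (bit (earlySplit? y)) _ e

-- One step of the upper bound recursion

-- What the recursion retains of an edge from x to y: only the entries with indices between
-- i lo and i hi matter, and i lo, …, i hi is the chain of indices of the upper bound argument.
record Arrow (i : ℕ → ℕ) (lo hi : ℕ) (x y : ℕ → ℕ) : Set where
  field
    x-mono  : ∀ {j l} → i lo ≤ j → j ≤ l → l ≤ i hi → x j ≤ x l
    y-mono  : ∀ {j l} → i lo ≤ j → j ≤ l → l ≤ i hi → y j ≤ y l
    below   : ∀ {j} → i lo ≤ j → j ≤ i hi → x j < y j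
    next≤   : ∀ {j} → i lo ≤ j → j < i hi → x (suc j) ≤ y j
    link    : ∀ {t} → lo ≤ t → t < hi → y (i t) ≤ x (i (suc t))

induct-up : ∀ (P : ℕ → Set) {a} → P a → (∀ {j} → a ≤ j → P j → P (suc j)) → ∀ {j} → a ≤ j → P j
induct-up P {a} base step p = go (≤⇒≤′ p)
  where
    go : ∀ {j} → a ≤′ j → P j
    go (≤′-reflexive refl) = base
    go (≤′-step q)         = step (≤′⇒≤ q) (go q)

induct-down : ∀ (P : ℕ → Set) {b k} → P k → (∀ {j} → b ≤ j → j < k → P (suc j) → P j) →
              ∀ {j} → b ≤ j → j ≤ k → P j
induct-down P {b} pk step b≤j j≤k = go (≤⇒≤′ j≤k) b≤j pk step
  where
    go : ∀ {j k} → j ≤′ k → b ≤ j → P k → (∀ {j} → b ≤ j → j < k → P (suc j) → P j) → P j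
    go (≤′-reflexive refl) b≤j pk step = pk
    go (≤′-step q) b≤j pk step =
      go q b≤j (step (≤-trans b≤j (≤′⇒≤ q)) ≤-refl pk) (λ b≤ j< → step b≤ (m≤n⇒m≤1+n j<))

module Steps (i : ℕ → ℕ) (i-step : ∀ t → i t ≤ i (suc t)) (K m : ℕ) where

  i-mono : ∀ {s t} → s ≤ t → i s ≤ i t
  i-mono {s} = induct-up (λ t → i s ≤ i t) ≤-refl (λ {t} _ p → ≤-trans p (i-step t))

  module _ {lo hi : ℕ} (hi≤K : i hi ≤ K) (x y : ℕ → ℕ)
           (A : Arrow i lo hi x y)
           (y-bound : ∀ j → y j < 2 ^ m)
           (xy : ShapeTransfer m K (i lo) (i (suc lo)) (i hi) x y)
           (yx : ShapeTransfer m K (i lo) (i (suc lo)) (i hi) y x) where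
    open Arrow A
    private
      module XY = ShapeTransfer xy
      module YX = ShapeTransfer yx
      a = i lo
      b = i (suc lo)
      k = i hi
      u = x a
      v = y a
      r = x k
      w = y k

    module Nonempty (lo<hi : lo < hi) where
      a≤b : a ≤ b
      a≤b = i-step lo

      b≤k : b ≤ k
      b≤k = i-mono lo<hi

      a≤k : a ≤ k
      a≤k = ≤-trans a≤b b≤k

      v≤xb : v ≤ x b
      v≤xb = link ≤-refl lo<hi

      v≤r : v ≤ r
      v≤r = ≤-trans v≤xb (x-mono a≤b b≤k ≤-refl)

      r<w : r < w
      r<w = below a≤k ≤-refl

      u<v : u < v
      u<v = below ≤-refl a≤k

      u≤r : u ≤ r
      u≤r = x-mono ≤-refl a≤k ≤-refl

      r<2^m : r < 2 ^ m
      r<2^m = <-trans r<w (y-bound k)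

      -- If the first splits agreed, then so would their positions j; but x (j + 1) ≤ y j
      -- puts x (j + 1) and y j on the same side.
      δ-first-differ : δ m u r ≢ δ m v w
      δ-first-differ e = contradiction (proj₂ (at-k)) (λ f → <⇒≢ 0<d (trans (sym (δ-refl m w)) f))
        where
          d = δ m v w
          0<d : 0 < d
          0<d = n≢0⇒n>0 λ z → <⇒≢ (≤-<-trans v≤r r<w) (δ≡0⇒≡ m (y-bound a) (y-bound k) z)
          rw<d : δ m r w < d
          rw<d = ≤∧≢⇒< (δ-suffix m v≤r (<⇒≤ r<w)) (λ f → δ-binary m u≤r (<⇒≤ r<w) (y-bound k) 0<d e f)
          Both : ℕ → Set
          Both j = j ≤ k → δ m (x j) r ≡ d × δ m (y j) w ≡ d
          step : ∀ {j} → a ≤ j → Both j → Both (suc j)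
          step {j} a≤j both j<k with both (<⇒≤ j<k) | δ m (y j) w ≟ δ m (y (suc j)) w
          ... | p , q | yes same = trans (sym (YX.toLast (≤-trans j<k hi≤K) same)) p , trans (sym same) q
          ... | p , q | no  diff = contradiction q (<⇒≢ (≤-<-trans (δ-suffix m (next≤ a≤j j<k) (y-mono a≤j (<⇒≤ j<k) ≤-refl))
                    (δ-ultrametric m (x (suc j)) r w
                      (≤∧≢⇒< (≤-trans (δ-suffix m (x-mono a≤j (n≤1+n j) j<k) (x-mono (m≤n⇒m≤1+n a≤j) j<k ≤-refl)) (≤-reflexive p))
                        (λ f → diff (XY.toLast (≤-trans j<k hi≤K) (trans p (sym f)))))
                      rw<d)))
          at-k = induct-up Both (λ _ → e , refl) step a≤k ≤-refl

    -- The split is early and the top chain index is dropped. Up to index `c` the elements of `y`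
    -- are at most `r`. The digits measured towards the last element decrease, and `m ∸` turns them
    -- into increasing sequences.
    module Left {h : ℕ} (hi≡ : hi ≡ suc h) (lo<h : lo < h) (early : EarlySplit m K a b k y) where
      lo<hi : lo < hi
      lo<hi = ≤-trans lo<h (≤-trans (n≤1+n h) (≤-reflexive (sym hi≡)))
      open Nonempty lo<hi

      c : ℕ
      c = i h

      c≤k : c ≤ k
      c≤k = subst (λ z → c ≤ i z) (sym hi≡) (i-step h)

      y≤r : ∀ {j} → a ≤ j → j ≤ c → y j ≤ r
      y≤r a≤j j≤c = ≤-trans (y-mono a≤j j≤c c≤k)
        (subst (λ z → y c ≤ x (i z)) (sym hi≡) (link (<⇒≤ lo<h) (≤-reflexive (sym hi≡))))

      rw≤ : ∀ {j} → a ≤ j → j ≤ c → δ m r w ≤ δ m (y j) w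
      rw≤ a≤j j≤c = δ-suffix m (y≤r a≤j j≤c) (<⇒≤ r<w)

      -- If the digit of `y` dropped at `j`, then `x (suc j)`, `r` and `w` would agree from position
      -- `δ m (y j) w` upwards, although `y j` lies between `x (suc j)` and `w`.
      stall : ∀ {j} → a ≤ j → suc j ≤ c → δ m (x (suc j)) r < δ m (y j) w → ToLastEq m K a b k y j
      stall {j} a≤j j<c p with toLastEq? m K a b k y j
      ... | yes q = q
      ... | no  q = contradiction
        (≤-<-trans (δ-suffix m (next≤ a≤j j<k) (y-mono a≤j (<⇒≤ j<k) ≤-refl))
          (δ-ultrametric m (x (suc j)) r w p
            (≤-<-trans (rw≤ (m≤n⇒m≤1+n a≤j) j<c)
              (≤∧≢⇒< (δ-suffix m (y-mono a≤j (n≤1+n j) j<k) (y-mono (m≤n⇒m≤1+n a≤j) j<k ≤-refl))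
                (λ e → q (sym e))))))
        (n≮n _)
        where j<k = ≤-trans j<c c≤k

      -- The early split makes `δ m r w` smaller than `δ m v w`. If `δ m u r` were smaller too, then
      -- so would be `δ m u w`, against `u < v`. Equality is excluded by `δ-first-differ`.
      decreasing-a : δ m v w < δ m u r
      decreasing-a = ≰⇒> λ p → contradiction
        (≤-<-trans (δ-suffix m (<⇒≤ u<v) (≤-trans v≤r (<⇒≤ r<w)))
          (δ-ultrametric m u r w (≤∧≢⇒< p δ-first-differ)
            (≤-<-trans (rw≤ a≤b (i-mono lo<h)) early)))
        (n≮n _)

      -- Where the digit of `y` stays the same, the shape makes that of `x` stay the same; where it
      -- drops, `stall` forces the inequality.
      decreasing : ∀ {j} → a ≤ j → j ≤ c → δ m (y j) w < δ m (x j) r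
      decreasing = induct-up (λ j → j ≤ c → δ m (y j) w < δ m (x j) r) (λ _ → decreasing-a) step
        where
          step : ∀ {j} → a ≤ j → (j ≤ c → δ m (y j) w < δ m (x j) r) →
                 suc j ≤ c → δ m (y (suc j)) w < δ m (x (suc j)) r
          step {j} a≤j ih j<c with toLastEq? m K a b k y j
          ... | yes q = subst₂ _<_ q (YX.toLast (≤-trans j<c (≤-trans c≤k hi≤K)) q) (ih (<⇒≤ j<c))
          ... | no  q = ≰⇒> λ p → q (stall a≤j j<c (≤-<-trans p
                 (≤∧≢⇒< (δ-suffix m (y-mono a≤j (n≤1+n j) (≤-trans j<c c≤k))
                          (y-mono (m≤n⇒m≤1+n a≤j) (≤-trans j<c c≤k) ≤-refl)) (λ e → q (sym e)))))

      arrow : Arrow i lo h (λ j → m ∸ δ m (x j) r) (λ j → m ∸ δ m (y j) w)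
      arrow = record
        { x-mono = λ a≤j j≤l l≤c → ∸-monoʳ-≤ m (δ-suffix m (x-mono a≤j j≤l (≤-trans l≤c c≤k))
                     (x-mono (≤-trans a≤j j≤l) (≤-trans l≤c c≤k) ≤-refl))
        ; y-mono = λ a≤j j≤l l≤c → ∸-monoʳ-≤ m (δ-suffix m (y-mono a≤j j≤l (≤-trans l≤c c≤k))
                     (y-mono (≤-trans a≤j j≤l) (≤-trans l≤c c≤k) ≤-refl))
        ; below  = λ a≤j j≤c → ∸-monoʳ-< (decreasing a≤j j≤c) (δ≤ m _ _)
        -- A violation makes `y` stall, hence also `x`, and then contradicts `decreasing` at `j`.
        ; next≤  = λ {j} a≤j j<c → ∸-monoʳ-≤ m (≮⇒≥ λ p →
                     let q = stall a≤j j<c p in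
                     <-asym (decreasing a≤j (<⇒≤ j<c))
                       (subst (_< δ m (y j) w) (sym (YX.toLast (≤-trans j<c (≤-trans c≤k hi≤K)) q)) p))
        ; link   = λ {t} lo≤t t<h → ∸-monoʳ-≤ m
                     (≤-trans (δ-suffix m (link lo≤t (≤-trans t<h (≤-trans (n≤1+n h) (≤-reflexive (sym hi≡)))))
                                (x-mono (≤-trans (i-mono lo≤t) (i-step t)) (≤-trans (i-mono t<h) c≤k) ≤-refl))
                       (δ-prefix m (y≤r (i-mono lo≤t) (i-mono (<⇒≤ t<h))) (<⇒≤ r<w)))
        }

    -- The mirror image of `Left`: the split is late, the bottom chain index is dropped, and digits
    -- measured from the first element increase without reversal. The induction runs down from `k`.
    module Right (lo+1<hi : suc lo < hi) (late : ¬ EarlySplit m K a b k x) where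
      open Nonempty (<⇒≤ lo+1<hi)

      v≤x : ∀ {j} → b ≤ j → j ≤ k → v ≤ x j
      v≤x b≤j j≤k = ≤-trans v≤xb (x-mono a≤b b≤j j≤k)

      uv≤ : ∀ {j} → b ≤ j → j ≤ k → δ m u v ≤ δ m u (x j)
      uv≤ b≤j j≤k = δ-prefix m (<⇒≤ u<v) (v≤x b≤j j≤k)

      u-mono : ∀ {j} → b ≤ j → j < k → δ m u (x j) ≤ δ m u (x (suc j))
      u-mono b≤j j<k = δ-prefix m (x-mono ≤-refl (≤-trans a≤b b≤j) (<⇒≤ j<k)) (x-mono (≤-trans a≤b b≤j) (n≤1+n _) j<k)

      stall : ∀ {j} → b ≤ j → j < k → δ m v (y j) < δ m u (x (suc j)) → FromFirstEq m K a b k x j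
      stall {j} b≤j j<k p with fromFirstEq? m K a b k x j
      ... | yes q = q
      ... | no  q = contradiction
        (≤-<-trans (δ-prefix m (x-mono ≤-refl (≤-trans a≤b (m≤n⇒m≤1+n b≤j)) j<k) (next≤ (≤-trans a≤b b≤j) j<k))
          (δ-ultrametric m u v (y j) (≤-<-trans (uv≤ b≤j (<⇒≤ j<k)) (≤∧≢⇒< (u-mono b≤j j<k) q)) p))
        (n≮n _)

      -- The late split leaves `x b`, hence also `v`, with the same digit as `u` at position
      -- `δ m u r`. If `δ m v w` were below this position, `w` would share that digit, although
      -- `u ≤ r < w`.
      increasing-k : δ m u r < δ m v w
      increasing-k = ≰⇒> λ p →
        let wv<ur = ≤∧≢⇒< p (λ e → δ-first-differ (sym e))
            0<ur  = ≤-<-trans z≤n wv<ur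
            u≤xb  = x-mono ≤-refl a≤b b≤k
            xb≤r  = x-mono a≤b b≤k ≤-refl
            uxb<  = ≤∧≢⇒< (δ-prefix m u≤xb xb≤r) (λ e → δ-binary m u≤xb xb≤r r<2^m 0<ur e
                      (≤-antisym (δ-suffix m u≤xb xb≤r) (≮⇒≥ late)))
        in contradiction
          (≤-<-trans (δ-prefix m u≤r (<⇒≤ r<w))
            (δ-ultrametric m u v w (≤-<-trans (uv≤ ≤-refl b≤k) uxb<) wv<ur))
          (n≮n _)

      increasing : ∀ {j} → b ≤ j → j ≤ k → δ m u (x j) < δ m v (y j)
      increasing = induct-down (λ j → δ m u (x j) < δ m v (y j)) increasing-k step
        where
          step : ∀ {j} → b ≤ j → j < k → δ m u (x (suc j)) < δ m v (y (suc j)) → δ m u (x j) < δ m v (y j)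
          step {j} b≤j j<k ih with fromFirstEq? m K a b k x j
          ... | yes q = subst₂ _<_ (sym q) (sym (XY.fromFirst (≤-trans j<k hi≤K) q)) ih
          ... | no  q = ≰⇒> λ p → q (stall b≤j j<k (≤-<-trans p (≤∧≢⇒< (u-mono b≤j j<k) q)))

      arrow : Arrow i (suc lo) hi (λ j → δ m u (x j)) (λ j → δ m v (y j))
      arrow = record
        { x-mono = λ b≤j j≤l l≤k → δ-prefix m (x-mono ≤-refl (≤-trans a≤b b≤j) (≤-trans j≤l l≤k)) (x-mono (≤-trans a≤b b≤j) j≤l l≤k)
        ; y-mono = λ b≤j j≤l l≤k → δ-prefix m (y-mono ≤-refl (≤-trans a≤b b≤j) (≤-trans j≤l l≤k)) (y-mono (≤-trans a≤b b≤j) j≤l l≤k)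
        ; below  = increasing
        ; next≤  = λ {j} b≤j j<k → ≮⇒≥ λ p →
                     let q = stall b≤j j<k p in
                     <-asym (increasing (m≤n⇒m≤1+n b≤j) j<k)
                       (subst (_< δ m u (x (suc j))) (XY.fromFirst (≤-trans j<k hi≤K) q) p)
        ; link   = λ {t} lo<t t<hi →
                     let a≤t  = i-mono (<⇒≤ lo<t)
                         t+1≤k = i-mono t<hi
                     in ≤-trans
                       (δ-prefix m (y-mono ≤-refl a≤t (≤-trans (i-step t) t+1≤k)) (link (<⇒≤ lo<t) t<hi))
                       (δ-suffix m (<⇒≤ u<v) (v≤x (i-mono (≤-trans lo<t (n≤1+n t))) t+1≤k))
        }

-- The recursive colouring

module Colour (i : ℕ → ℕ) (i-step : ∀ t → i t ≤ i (suc t)) (K : ℕ) where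
  open Steps i i-step K

  shapes : ℕ
  shapes = 2 * (2 ^ K * 2 ^ K)

  digits : ℕ → ℕ
  digits n = suc ⌊log₂ n ⌋

  shapeOf : ℕ → ℕ → ℕ → (ℕ → ℕ) → Fin shapes
  shapeOf n lo hi = shape (digits n) K (i lo) (i (suc lo)) (i hi)

  Early : ℕ → ℕ → ℕ → (ℕ → ℕ) → Set
  Early n lo hi = EarlySplit (digits n) K (i lo) (i (suc lo)) (i hi)

  early? : ∀ n lo hi x → Dec (Early n lo hi x)
  early? n lo hi = earlySplit? (digits n) K (i lo) (i (suc lo)) (i hi)

  toLast fromFirst : ℕ → ℕ → ℕ → (ℕ → ℕ) → ℕ → ℕ
  toLast    n lo hi x j = digits n ∸ δ (digits n) (x j) (x (i hi))
  fromFirst n lo hi x j = δ (digits n) (x (i lo)) (x j)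

  toLast< : ∀ n lo hi x j → toLast n lo hi x j < suc (digits n)
  toLast< n lo hi x j = s≤s (m∸n≤m (digits n) (δ (digits n) (x j) (x (i hi))))

  fromFirst< : ∀ n lo hi x j → fromFirst n lo hi x j < suc (digits n)
  fromFirst< n lo hi x j = s≤s (δ≤ (digits n) (x (i lo)) (x j))

  -- `c` counts the links left in the chain. The case of one link uses the top differing digit
  -- directly, since `Left` and `Right` require that a link survives. In `subcolour` the decision is
  -- an argument, so that it can be matched for both endpoints at once.
  colour    : (c lo hi n : ℕ) (x : ℕ → ℕ) → (∀ j → x j < n) → Fin (paletteSize shapes c n)
  subcolour : (c lo hi n : ℕ) (x : ℕ → ℕ) → Dec (Early n lo hi x) → Fin (paletteSize shapes c (suc (digits n)))

  colour zero          lo hi n x x<n = fromℕ< (x<n (i lo))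
  colour (suc zero)    lo hi n x x<n =
    combine (shapeOf n lo hi x) (fromℕ< (fromFirst< n lo hi x (i hi)))
  colour (suc (suc c)) lo hi n x x<n =
    combine (shapeOf n lo hi x) (subcolour (suc c) lo hi n x (early? n lo hi x))

  subcolour c lo hi n x (yes _) =
    colour c lo (pred hi) (suc (digits n)) (toLast n lo hi x) (toLast< n lo hi x)
  subcolour c lo hi n x (no  _) =
    colour c (suc lo) hi (suc (digits n)) (fromFirst n lo hi x) (fromFirst< n lo hi x)

  Proper : ℕ → Set
  Proper c = ∀ (lo hi n : ℕ) (x y : ℕ → ℕ) (x<n : ∀ j → x j < n) (y<n : ∀ j → y j < n) →
    c + lo ≡ hi → i hi ≤ K → Arrow i lo hi x y → colour c lo hi n x x<n ≢ colour c lo hi n y y<n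

  colour-proper : ∀ c → Proper c
  colour-proper zero lo .lo n x y x<n y<n refl hi≤K A e =
    <⇒≢ (Arrow.below A ≤-refl ≤-refl) (fromℕ<-injective (x (i lo)) (y (i lo)) (x<n (i lo)) (y<n (i lo)) e)
  colour-proper (suc zero) lo .(suc lo) n x y x<n y<n refl hi≤K A e =
    Nonempty.δ-first-differ m hi≤K x y A (λ j → <-≤-trans (y<n j) (<⇒≤ (n<2^[1+⌊log₂n⌋] n)))
      (shape-transfer m K a b b x y same) (shape-transfer m K a b b y x (sym same)) ≤-refl
      (fromℕ<-injective (fromFirst n lo (suc lo) x b) (fromFirst n lo (suc lo) y b)
        (fromFirst< n lo (suc lo) x b) (fromFirst< n lo (suc lo) y b)
        (combine-injectiveʳ (shapeOf n lo (suc lo) x) cx (shapeOf n lo (suc lo) y) cy e))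
    where
      m = digits n
      a = i lo
      b = i (suc lo)
      cx = fromℕ< (fromFirst< n lo (suc lo) x b)
      cy = fromℕ< (fromFirst< n lo (suc lo) y b)
      same = combine-injectiveˡ (shapeOf n lo (suc lo) x) cx (shapeOf n lo (suc lo) y) cy e
  colour-proper (suc (suc c)) lo .(suc (suc c) + lo) n x y x<n y<n refl hi≤K A e =
    go (colour-proper (suc c)) (early? n lo hi x) (early? n lo hi y)
      (combine-injectiveʳ (shapeOf n lo hi x) cx (shapeOf n lo hi y) cy e)
    where
      m = digits n
      hi = suc (suc c) + lo
      cx = subcolour (suc c) lo hi n x (early? n lo hi x)
      cy = subcolour (suc c) lo hi n y (early? n lo hi y)
      same = combine-injectiveˡ (shapeOf n lo hi x) cx (shapeOf n lo hi y) cy e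
      y<2^m : ∀ j → y j < 2 ^ m
      y<2^m j = <-≤-trans (y<n j) (<⇒≤ (n<2^[1+⌊log₂n⌋] n))
      xy = shape-transfer m K (i lo) (i (suc lo)) (i hi) x y same
      yx = shape-transfer m K (i lo) (i (suc lo)) (i hi) y x (sym same)
      go : Proper (suc c) → (p : Dec (Early n lo hi x)) (q : Dec (Early n lo hi y)) →
           subcolour (suc c) lo hi n x p ≢ subcolour (suc c) lo hi n y q
      -- The shapes agree, so both endpoints take the same branch.
      go _ (yes p) (no ¬q) _ = ¬q (ShapeTransfer.early xy p)
      go _ (no ¬p) (yes q) _ = ¬p (ShapeTransfer.early yx q)
      go ih (yes p) (yes q) = ih lo (suc c + lo) (suc m)
        (toLast n lo hi x) (toLast n lo hi y) (toLast< n lo hi x) (toLast< n lo hi y) refl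
        (≤-trans (i-step (suc c + lo)) hi≤K)
        (Left.arrow m hi≤K x y A y<2^m xy yx refl (s≤s (m≤n+m lo c)) q)
      go ih (no ¬p) (no ¬q) = ih (suc lo) hi (suc m)
        (fromFirst n lo hi x) (fromFirst n lo hi y) (fromFirst< n lo hi x) (fromFirst< n lo hi y)
        (cong suc (+-suc c lo)) hi≤K
        (Right.arrow m hi≤K x y A y<2^m xy yx (s≤s (s≤s (m≤n+m lo c))) ¬p)

-- Irreducible types and their blocks

-- Irreducible types as walks: Run e r says that a walk at height e that goes up at
-- every 1 and down at every 2 reaches 0 exactly at the end of r.
data Run : ℕ → Seq → Set where
  done  : Run 0 []
  one   : ∀ {e r} → Run (suc (suc e)) r → Run (suc e) (one ∷ r)
  two   : ∀ {e r} → Run e r → Run (suc e) (two ∷ r)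
  three : ∀ {e r} → Run (suc e) r → Run (suc e) (three ∷ r)

Run-balance : ∀ {e r} → Run e r → e + ones r ≡ twos r
Run-balance done      = refl
Run-balance {e} (one {r = r} p) = trans (+-suc e (ones r)) (Run-balance p)
Run-balance (two p)   = cong suc (Run-balance p)
Run-balance {e} (three {r = r} p) = trans (+-suc e (ones r)) (cong suc (Run-balance p))

ones-++ : ∀ A B → ones (A ++ B) ≡ ones A + ones B
ones-++ []          B = refl
ones-++ (one ∷ A)   B = cong suc (ones-++ A B)
ones-++ (two ∷ A)   B = ones-++ A B
ones-++ (three ∷ A) B = cong suc (ones-++ A B)

twos-++ : ∀ A B → twos (A ++ B) ≡ twos A + twos B
twos-++ []          B = refl
twos-++ (one ∷ A)   B = twos-++ A B
twos-++ (two ∷ A)   B = cong suc (twos-++ A B)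
twos-++ (three ∷ A) B = cong suc (twos-++ A B)

ones-swap : ∀ A → ones (map swap12 A) ≡ twos A
ones-swap []          = refl
ones-swap (one ∷ A)   = ones-swap A
ones-swap (two ∷ A)   = cong suc (ones-swap A)
ones-swap (three ∷ A) = cong suc (ones-swap A)

twos-swap : ∀ A → twos (map swap12 A) ≡ ones A
twos-swap []          = refl
twos-swap (one ∷ A)   = cong suc (twos-swap A)
twos-swap (two ∷ A)   = twos-swap A
twos-swap (three ∷ A) = cong suc (twos-swap A)

swap-involutive : ∀ A → map swap12 (map swap12 A) ≡ A
swap-involutive []          = refl
swap-involutive (one ∷ A)   = cong (one ∷_) (swap-involutive A)
swap-involutive (two ∷ A)   = cong (two ∷_) (swap-involutive A)
swap-involutive (three ∷ A) = cong (three ∷_) (swap-involutive A)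

orderType-swap : ∀ {n} (X Y : Subset n) → orderType Y X ≡ map swap12 (orderType X Y)
orderType-swap []             []             = refl
orderType-swap (inside  ∷ X) (inside  ∷ Y) = cong (three ∷_) (orderType-swap X Y)
orderType-swap (inside  ∷ X) (outside ∷ Y) = cong (two ∷_) (orderType-swap X Y)
orderType-swap (outside ∷ X) (inside  ∷ Y) = cong (one ∷_) (orderType-swap X Y)
orderType-swap (outside ∷ X) (outside ∷ Y) = orderType-swap X Y

ones-orderType : ∀ {n} (X Y : Subset n) → ones (orderType X Y) ≡ ∣ X ∣
ones-orderType []             []             = refl
ones-orderType (inside  ∷ X) (inside  ∷ Y) = cong suc (ones-orderType X Y)
ones-orderType (inside  ∷ X) (outside ∷ Y) = cong suc (ones-orderType X Y)
ones-orderType (outside ∷ X) (inside  ∷ Y) = ones-orderType X Y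
ones-orderType (outside ∷ X) (outside ∷ Y) = ones-orderType X Y

twos-orderType : ∀ {n} (X Y : Subset n) → twos (orderType X Y) ≡ ∣ Y ∣
twos-orderType X Y = trans (sym (ones-swap (orderType X Y)))
  (trans (cong ones (sym (orderType-swap X Y))) (ones-orderType Y X))

-- Elements of a pair and its order type

-- Counted from 0; nth X j = n when X has at most j elements.
nth : ∀ {n} → Subset n → ℕ → ℕ
nth []            j       = 0
nth (inside  ∷ X) zero    = 0
nth (inside  ∷ X) (suc j) = suc (nth X j)
nth (outside ∷ X) j       = suc (nth X j)

nth≤n : ∀ {n} (X : Subset n) j → nth X j ≤ n
nth≤n []            j       = z≤n
nth≤n (inside  ∷ X) zero    = z≤n
nth≤n (inside  ∷ X) (suc j) = s≤s (nth≤n X j)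
nth≤n (outside ∷ X) j       = s≤s (nth≤n X j)

nth-mono-≤ : ∀ {n} (X : Subset n) {j l} → j ≤ l → nth X j ≤ nth X l
nth-mono-≤ []            p       = z≤n
nth-mono-≤ (inside  ∷ X) z≤n     = z≤n
nth-mono-≤ (inside  ∷ X) (s≤s p) = s≤s (nth-mono-≤ X p)
nth-mono-≤ (outside ∷ X) p       = s≤s (nth-mono-≤ X p)

nth-mono-< : ∀ {n} (X : Subset n) {j l} → j < l → j < ∣ X ∣ → nth X j < nth X l
nth-mono-< (inside  ∷ X) {zero}  (s≤s p) _       = s≤s z≤n
nth-mono-< (inside  ∷ X) {suc j} (s≤s p) (s≤s q) = s≤s (nth-mono-< X p q)
nth-mono-< (outside ∷ X) p q                     = s≤s (nth-mono-< X p q)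

-- What is left of the pair after the entries `P`; this isolates one factor inside a longer type.
-- Positions move by `offset`, indices by the number of elements that each set has in `P`.
record Suffix {n} (X Y : Subset n) (P Q : Seq) : Set where
  field
    {size}   : ℕ
    offset   : ℕ
    X′ Y′    : Subset size
    type     : orderType X′ Y′ ≡ Q
    X-suffix : ∀ j → nth X (ones P + j) ≡ offset + nth X′ j
    Y-suffix : ∀ j → nth Y (twos P + j) ≡ offset + nth Y′ j

suffix : ∀ {n} (X Y : Subset n) P Q → orderType X Y ≡ P ++ Q → Suffix X Y P Q
suffix X Y [] Q e = record { offset = 0 ; X′ = X ; Y′ = Y ; type = e ; X-suffix = λ _ → refl ; Y-suffix = λ _ → refl }
suffix [] [] (c ∷ P) Q ()
suffix (outside ∷ X) (outside ∷ Y) (c ∷ P) Q e = record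
  { offset = suc S.offset ; X′ = S.X′ ; Y′ = S.Y′ ; type = S.type
  ; X-suffix = λ j → cong suc (S.X-suffix j) ; Y-suffix = λ j → cong suc (S.Y-suffix j) }
  where module S = Suffix (suffix X Y (c ∷ P) Q e)
suffix (inside ∷ X) (outside ∷ Y) (one ∷ P) Q e = record
  { offset = suc S.offset ; X′ = S.X′ ; Y′ = S.Y′ ; type = S.type
  ; X-suffix = λ j → cong suc (S.X-suffix j) ; Y-suffix = λ j → cong suc (S.Y-suffix j) }
  where module S = Suffix (suffix X Y P Q (∷-injectiveʳ e))
suffix (outside ∷ X) (inside ∷ Y) (two ∷ P) Q e = record
  { offset = suc S.offset ; X′ = S.X′ ; Y′ = S.Y′ ; type = S.type
  ; X-suffix = λ j → cong suc (S.X-suffix j) ; Y-suffix = λ j → cong suc (S.Y-suffix j) }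
  where module S = Suffix (suffix X Y P Q (∷-injectiveʳ e))
suffix (inside ∷ X) (inside ∷ Y) (three ∷ P) Q e = record
  { offset = suc S.offset ; X′ = S.X′ ; Y′ = S.Y′ ; type = S.type
  ; X-suffix = λ j → cong suc (S.X-suffix j) ; Y-suffix = λ j → cong suc (S.Y-suffix j) }
  where module S = Suffix (suffix X Y P Q (∷-injectiveʳ e))

-- Before the element of `X` with index `j` is read, the height is `suc e + j` minus the number of
-- elements of `Y` read so far. It is positive, so the element of `Y` with index `e + j` has not
-- been passed.
Run⇒nth≤ : ∀ {n} (X Y : Subset n) {e r S} → Run (suc e) r → orderType X Y ≡ r ++ S →
           ∀ {j} → j < ones r → nth X j ≤ nth Y (e + j)
Run⇒nth≤ [] [] _ _ _ = z≤n
Run⇒nth≤ (outside ∷ X) (outside ∷ Y) p eq q = s≤s (Run⇒nth≤ X Y p eq q)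
Run⇒nth≤ (inside ∷ X) (outside ∷ Y) (one p) eq {zero} q = z≤n
Run⇒nth≤ (inside ∷ X) (outside ∷ Y) {e} (one p) eq {suc j} (s≤s q) rewrite +-suc e j =
  s≤s (Run⇒nth≤ X Y p (∷-injectiveʳ eq) q)
Run⇒nth≤ (outside ∷ X) (inside ∷ Y) {zero} (two done) eq ()
Run⇒nth≤ (outside ∷ X) (inside ∷ Y) {suc e} (two p) eq q = s≤s (Run⇒nth≤ X Y p (∷-injectiveʳ eq) q)
Run⇒nth≤ (inside ∷ X) (inside ∷ Y) (three p) eq {zero} q = z≤n
Run⇒nth≤ (inside ∷ X) (inside ∷ Y) {e} (three p) eq {suc j} (s≤s q) rewrite +-suc e j =
  s≤s (Run⇒nth≤ X Y p (∷-injectiveʳ eq) q)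

primary-first : ∀ {n} (X Y : Subset n) {T} → orderType X Y ≡ one ∷ T → nth X 0 < nth Y 0
primary-first [] [] ()
primary-first (outside ∷ X) (outside ∷ Y) eq = s≤s (primary-first X Y eq)
primary-first (inside  ∷ X) (outside ∷ Y) eq = s≤s z≤n

primary-next : ∀ {n} (X Y : Subset n) {r S} → Run 1 r → orderType X Y ≡ one ∷ r ++ S →
               ∀ {j} → j < ones r → nth X (suc j) ≤ nth Y j
primary-next [] [] _ _ _ = z≤n
primary-next (outside ∷ X) (outside ∷ Y) p eq q = s≤s (primary-next X Y p eq q)
primary-next (inside  ∷ X) (outside ∷ Y) p eq q = s≤s (Run⇒nth≤ X Y p (∷-injectiveʳ eq) q)

-- Block starts as iterated jumps

-- The number of entries 1 or 3 preceding the j-th entry (from 0) equal to 2 or 3, so that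
-- blocks are delimited by the iterates of jump r on 0.
jump : Seq → ℕ → ℕ
jump []          j       = 0
jump (one   ∷ r) j       = suc (jump r j)
jump (two   ∷ r) zero    = 0
jump (two   ∷ r) (suc j) = jump r j
jump (three ∷ r) zero    = 0
jump (three ∷ r) (suc j) = suc (jump r j)

jump-link : ∀ {n} (X Y : Subset n) r {S} → orderType X Y ≡ r ++ S →
            ∀ {j} → j < twos r → nth Y j ≤ nth X (jump r j)
jump-link [] [] _ _ _ = z≤n
jump-link (outside ∷ X) (outside ∷ Y) (c ∷ r) eq q = s≤s (jump-link X Y (c ∷ r) eq q)
jump-link (inside ∷ X) (outside ∷ Y) (one ∷ r) eq q = s≤s (jump-link X Y r (∷-injectiveʳ eq) q)
jump-link (outside ∷ X) (inside ∷ Y) (two ∷ r) eq {zero} q = z≤n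
jump-link (outside ∷ X) (inside ∷ Y) (two ∷ r) eq {suc j} (s≤s q) = s≤s (jump-link X Y r (∷-injectiveʳ eq) q)
jump-link (inside ∷ X) (inside ∷ Y) (three ∷ r) eq {zero} q = z≤n
jump-link (inside ∷ X) (inside ∷ Y) (three ∷ r) eq {suc j} (s≤s q) = s≤s (jump-link X Y r (∷-injectiveʳ eq) q)

jump≤ones : ∀ r j → jump r j ≤ ones r
jump≤ones []          j       = z≤n
jump≤ones (one   ∷ r) j       = s≤s (jump≤ones r j)
jump≤ones (two   ∷ r) zero    = z≤n
jump≤ones (two   ∷ r) (suc j) = jump≤ones r j
jump≤ones (three ∷ r) zero    = z≤n
jump≤ones (three ∷ r) (suc j) = s≤s (jump≤ones r j)

-- The right side minus the left is the height of the walk just before the entry in question, or at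
-- the end of the walk.
≤-jump : ∀ {e r} → Run e r → ∀ {j} → j ≤ twos r → j ≤ e + jump r j
≤-jump done z≤n = z≤n
≤-jump {e} (one {r = r} p) {j} q = ≤-trans (≤-jump p q) (≤-reflexive (sym (+-suc e (jump r j))))
≤-jump (two p) {zero} q = z≤n
≤-jump (two p) {suc j} (s≤s q) = s≤s (≤-jump p q)
≤-jump (three p) {zero} q = z≤n
≤-jump {e} (three {r = r} p) {suc j} (s≤s q) = ≤-trans (s≤s (≤-jump p q)) (≤-reflexive (sym (+-suc e (jump r j))))

blockStart : Seq → ℕ → ℕ
blockStart ρ zero    = 0
blockStart ρ (suc t) = jump ρ (blockStart ρ t)

blockStart≤ones : ∀ ρ t → blockStart ρ t ≤ ones ρ
blockStart≤ones ρ zero    = z≤n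
blockStart≤ones ρ (suc t) = jump≤ones ρ (blockStart ρ t)

blockStart-step : ∀ {r} → Run 1 r → ∀ t → blockStart (one ∷ r) t ≤ blockStart (one ∷ r) (suc t)
blockStart-step {r} p t = ≤-jump p (≤-trans (blockStart≤ones (one ∷ r) t) (≤-reflexive (Run-balance p)))

-- s and a count the entries equal to 2 or 3, and to 1 or 3, read before r.
inBlock-blockStart : ∀ ρ {k c} t need next s a r → Run (need + next) r →
  (∀ j → jump ρ (s + j) ≡ a + jump r j) → s + twos r ≡ k →
  blockStart ρ t ≡ s + need → a ≡ s + need + next → (∀ {t′} → t ≡ suc t′ → blockStart ρ t′ < k) →
  inBlock (suc t) need next r ≡ suc (suc c) → blockStart ρ c < k
-- At the end `t` is `suc c`, so the bound wanted is the one carried along for the block before the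
-- current one.
inBlock-blockStart ρ t need next s a [] p G refl B N H refl = H refl
inBlock-blockStart ρ {k} t need next s a (one ∷ r) p G K B N H e =
  inBlock-blockStart ρ t need (suc next) s (suc a) r p′
    (λ j → trans (G j) (+-suc a (jump r j))) K B (trans (cong suc N) (sym (+-suc (s + need) next))) H e
  where
    p′ : Run (need + suc next) r
    p′ rewrite +-suc need next = step p
      where
        step : ∀ {e} → Run e (one ∷ r) → Run (suc e) r
        step (one q) = q
inBlock-blockStart ρ t (suc need) next s a (two ∷ r) (two p) G K B N H e =
  inBlock-blockStart ρ t need next (suc s) a r p
    (λ j → trans (cong (jump ρ) (sym (+-suc s j))) (G (suc j)))
    (trans (sym (+-suc s _)) K) (trans B (+-suc s need)) (trans N (cong (_+ next) (+-suc s need))) H e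
inBlock-blockStart ρ t (suc need) next s a (three ∷ r) (three p) G K B N H e =
  inBlock-blockStart ρ t need (suc next) (suc s) (suc a) r (subst (λ z → Run z r) (sym (+-suc need next)) p)
    (λ j → trans (cong (jump ρ) (sym (+-suc s j))) (trans (G (suc j)) (+-suc a (jump r j))))
    (trans (sym (+-suc s _)) K) (trans B (+-suc s need))
    (cong suc (trans N (trans (cong (_+ next) (+-suc s need)) (sym (+-suc (s + need) next))))) H e
inBlock-blockStart ρ {k} t zero (suc m) s a (two ∷ r) (two p) G K B N H e =
  inBlock-blockStart ρ (suc t) m 0 (suc s) a r (subst (λ z → Run z r) (sym (+-identityʳ m)) p)
    (λ j → trans (cong (jump ρ) (sym (+-suc s j))) (G (suc j)))
    (trans (sym (+-suc s _)) K) (trans new N′) (trans N′ (sym (+-identityʳ (suc s + m))))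
    (λ { refl → ≤-trans (≤-reflexive (cong suc (trans B (+-identityʳ s))))
                  (≤-trans (m<m+n s (s≤s z≤n)) (≤-reflexive K)) }) e
  where
    new : blockStart ρ (suc t) ≡ a
    new = trans (cong (jump ρ) B) (trans (G 0) (+-identityʳ a))
    N′ : a ≡ suc s + m
    N′ = trans N (trans (cong (_+ suc m) (+-identityʳ s)) (+-suc s m))
inBlock-blockStart ρ {k} t zero (suc m) s a (three ∷ r) (three p) G K B N H e =
  inBlock-blockStart ρ (suc t) m 1 (suc s) (suc a) r (subst (λ z → Run z r) (+-comm 1 m) p)
    (λ j → trans (cong (jump ρ) (sym (+-suc s j))) (trans (G (suc j)) (+-suc a (jump r j))))
    (trans (sym (+-suc s _)) K) (trans new N′) (trans (cong suc N′) (+-comm 1 (suc s + m)))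
    (λ { refl → ≤-trans (≤-reflexive (cong suc (trans B (+-identityʳ s))))
                  (≤-trans (m<m+n s (s≤s z≤n)) (≤-reflexive K)) }) e
  where
    new : blockStart ρ (suc t) ≡ a
    new = trans (cong (jump ρ) B) (trans (G 0) (+-identityʳ a))
    N′ : a ≡ suc s + m
    N′ = trans N (trans (cong (_+ suc m) (+-identityʳ s)) (+-suc s m))

firstBlock≡inBlock : ∀ k r → firstBlock k r ≡ inBlock 1 0 k r
firstBlock≡inBlock k []          = refl
firstBlock≡inBlock k (one ∷ r)   = firstBlock≡inBlock (suc k) r
firstBlock≡inBlock k (two ∷ r)   = refl
firstBlock≡inBlock k (three ∷ r) = refl

-- The penultimate of the `c + 2` blocks begins at index `blockStart (one ∷ r) c`. It contains an
-- entry 1 or 3, since a last block is opened only when some are due.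
primaryBlocks-blockStart : ∀ {r c} → Run 1 r → primaryBlocks (one ∷ r) ≡ suc (suc c) →
                           blockStart (one ∷ r) c < ones (one ∷ r)
primaryBlocks-blockStart {r} p e =
  inBlock-blockStart (one ∷ r) 0 0 1 0 1 r p (λ _ → refl) (sym (Run-balance p)) refl refl (λ ())
    (trans (sym (firstBlock≡inBlock 1 r)) e)

-- Colouring by a single factor

primary-arrow : ∀ {n} (X Y : Subset n) P r S c → Run 1 r → blockStart (one ∷ r) c < ones (one ∷ r) →
  ones P ≡ twos P → orderType X Y ≡ P ++ (one ∷ r) ++ S →
  Arrow (blockStart (one ∷ r)) 0 c (λ j → nth X (ones P + j)) (λ j → nth Y (ones P + j))
primary-arrow X Y P r S c p c<k P-bal eq = record
  { x-mono = λ _ q _ → nth-mono-≤ X (+-monoʳ-≤ (ones P) q)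
  ; y-mono = λ _ q _ → nth-mono-≤ Y (+-monoʳ-≤ (ones P) q)
  ; below  = λ {j} _ q → subst₂ _<_ (sym (X-suffix j)) (sym (Y-suffix′ j)) (+-monoʳ-< offset (below j (≤-<-trans q c<k)))
  ; next≤  = λ {j} _ q → subst₂ _≤_ (sym (X-suffix (suc j))) (sym (Y-suffix′ j))
      (+-monoʳ-≤ offset (primary-next X′ Y′ p type (≤-trans q (s≤s⁻¹ c<k))))
  ; link   = λ {t} _ q → subst₂ _≤_ (sym (Y-suffix′ _)) (sym (X-suffix _))
      (+-monoʳ-≤ offset (jump-link X′ Y′ (one ∷ r) type
        (≤-trans (≤-<-trans (blockStart-mono (<⇒≤ q)) c<k) (≤-reflexive (Run-balance p)))))
  }
  where
    open Suffix (suffix X Y P ((one ∷ r) ++ S) eq)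
    Y-suffix′ : ∀ j → nth Y (ones P + j) ≡ offset + nth Y′ j
    Y-suffix′ j rewrite P-bal = Y-suffix j
    blockStart-mono : ∀ {s t} → s ≤ t → blockStart (one ∷ r) s ≤ blockStart (one ∷ r) t
    blockStart-mono = Steps.i-mono (blockStart (one ∷ r)) (blockStart-step p) 0 0
    ones≤Y : ones (one ∷ r) ≤ ∣ Y′ ∣
    ones≤Y = ≤-trans (≤-reflexive (Run-balance p)) (≤-trans (m≤m+n _ (twos S))
      (≤-reflexive (trans (sym (twos-++ (one ∷ r) S)) (trans (cong twos (sym type)) (twos-orderType X′ Y′)))))
    below : ∀ j → j < ones (one ∷ r) → nth X′ j < nth Y′ j
    below zero    _       = primary-first X′ Y′ type
    below (suc j) (s≤s q) = ≤-<-trans (primary-next X′ Y′ p type q)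
      (nth-mono-< Y′ ≤-refl (≤-trans (m≤n⇒m≤1+n q) ones≤Y))

-- Only one direction of an edge is considered; `colourable` symmetrises. The palette is that of
-- `suc n` because `nth` can take the value `n`.
record FactorColouring (τ : Seq) (c : ℕ) : Set where
  field
    shapeCount  : ℕ
    vertexColour  : ∀ {n} → Subset n → Fin (paletteSize shapeCount c (suc n))
    distinct : ∀ {n} (X Y : Subset n) → orderType X Y ≡ τ → vertexColour X ≢ vertexColour Y

primary-colouring : ∀ {P r S c} → Run 1 r → primaryBlocks (one ∷ r) ≡ suc (suc c) → ones P ≡ twos P →
                    FactorColouring (P ++ (one ∷ r) ++ S) c
primary-colouring {P} {r} {S} {c} p e P-bal = record
  { shapeCount  = shapes
  ; vertexColour  = λ {n} X → colour c 0 c (suc n) (λ j → nth X (ones P + j)) (λ j → s≤s (nth≤n X (ones P + j)))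
  ; distinct = λ {n} X Y eq → colour-proper c 0 c (suc n)
      (λ j → nth X (ones P + j)) (λ j → nth Y (ones P + j))
      (λ j → s≤s (nth≤n X (ones P + j))) (λ j → s≤s (nth≤n Y (ones P + j)))
      (+-identityʳ c) (<⇒≤ c<k) (primary-arrow X Y P r S c p c<k P-bal eq)
  }
  where
    c<k = primaryBlocks-blockStart p e
    open Colour (blockStart (one ∷ r)) (blockStart-step p) (ones (one ∷ r))

-- Adjacency is symmetric, so exchanging the endpoints reduces this to the primary case.
secondary-colouring : ∀ {P r S c} → Run 1 (map swap12 r) → numBlocks (two ∷ r) ≡ suc (suc c) → ones P ≡ twos P →
                      FactorColouring (P ++ (two ∷ r) ++ S) c
secondary-colouring {P} {r} {S} p e P-bal = record
  { shapeCount = shapeCount ; vertexColour = vertexColour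
  ; distinct = λ X Y eq f → distinct Y X (trans (orderType-swap X Y)
      (trans (cong (map swap12) eq) (trans (map-++ swap12 P _) (cong (map swap12 P ++_) (map-++ swap12 (two ∷ r) S))))) (sym f) }
  where
    open FactorColouring (primary-colouring {map swap12 P} {S = map swap12 S} p e
      (trans (ones-swap P) (trans (sym P-bal) (sym (twos-swap P)))))

colourable : ∀ {τ c} → FactorColouring τ c →
  ∃ λ b → ∃ λ N → ∀ n → N ≤ n → Σ ℕ λ m → m ≤ b * logIter c n × Colourable τ n m
colourable {c = c} F = let b , N , h = paletteSize-bound shapeCount c 1 in
  b , N , λ n N≤n → _ , h n N≤n ,
    (λ (X , _) → vertexColour X) ,
    λ { (X , _) (Y , _) (inj₁ eq) → distinct X Y eq
      ; (X , _) (Y , _) (inj₂ eq) f → distinct Y X eq (sym f) }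
  where open FactorColouring F

Colourable-mono : ∀ {τ n m m′} → m ≤ m′ → Colourable τ n m → Colourable τ n m′
Colourable-mono p (f , h) = (λ v → inject≤ (f v) p) ,
  λ u v adj e → h u v adj (inject≤-injective p p _ _ e)

-- Order types of merged lists

-- Merge hi lo τ xs ys: increasing lists in [lo, hi) whose order type is τ.
data Merge (hi : ℕ) : ℕ → Seq → List ℕ → List ℕ → Set where
  done  : ∀ {lo} → lo ≤ hi → Merge hi lo [] [] []
  one   : ∀ {lo p τ xs ys} → lo ≤ p → Merge hi (suc p) τ xs ys → Merge hi lo (one ∷ τ) (p ∷ xs) ys
  two   : ∀ {lo p τ xs ys} → lo ≤ p → Merge hi (suc p) τ xs ys → Merge hi lo (two ∷ τ) xs (p ∷ ys)
  three : ∀ {lo p τ xs ys} → lo ≤ p → Merge hi (suc p) τ xs ys → Merge hi lo (three ∷ τ) (p ∷ xs) (p ∷ ys)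

merge-bounds : ∀ {hi lo τ xs ys} → Merge hi lo τ xs ys → lo ≤ hi
merge-bounds (done q)    = q
merge-bounds (one q m)   = ≤-trans q (<⇒≤ (merge-bounds m))
merge-bounds (two q m)   = ≤-trans q (<⇒≤ (merge-bounds m))
merge-bounds (three q m) = ≤-trans q (<⇒≤ (merge-bounds m))

merge-lower : ∀ {hi lo lo′ τ xs ys} → lo′ ≤ lo → Merge hi lo τ xs ys → Merge hi lo′ τ xs ys
merge-lower p (done q)    = done (≤-trans p q)
merge-lower p (one q m)   = one (≤-trans p q) m
merge-lower p (two q m)   = two (≤-trans p q) m
merge-lower p (three q m) = three (≤-trans p q) m

merge-++ : ∀ {hi mid lo τ τ′ xs xs′ ys ys′} → Merge mid lo τ xs ys → Merge hi mid τ′ xs′ ys′ →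
           Merge hi lo (τ ++ τ′) (xs ++ xs′) (ys ++ ys′)
merge-++ (done q)    m′ = merge-lower q m′
merge-++ (one q m)   m′ = one q (merge-++ m m′)
merge-++ (two q m)   m′ = two q (merge-++ m m′)
merge-++ (three q m) m′ = three q (merge-++ m m′)

merge-map : ∀ {hi lo hi′ lo′ τ xs ys} (f : ℕ → ℕ) → (∀ {p q} → p < q → q < hi → f p < f q) →
            (∀ {p} → p < hi → f p < hi′) → lo′ ≤ hi′ → (∀ {p} → lo ≤ p → p < hi → lo′ ≤ f p) →
            Merge hi lo τ xs ys → Merge hi′ lo′ τ (map f xs) (map f ys)
merge-map f mono bnd p low (done q) = done p
merge-map f mono bnd p low (one q m) =
  -- Beyond `p` the lower bound is `suc (f p)`, so monotonicity of `f` takes the place of `low`.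
  one (low q (merge-bounds m)) (merge-map f mono bnd (bnd (merge-bounds m)) mono m)
merge-map f mono bnd p low (two q m) =
  two (low q (merge-bounds m)) (merge-map f mono bnd (bnd (merge-bounds m)) mono m)
merge-map f mono bnd p low (three q m) =
  three (low q (merge-bounds m)) (merge-map f mono bnd (bnd (merge-bounds m)) mono m)

merge-upper : ∀ {hi hi′ lo τ xs ys} → hi ≤ hi′ → Merge hi lo τ xs ys → Merge hi′ lo τ xs ys
merge-upper p (done q)    = done (≤-trans q p)
merge-upper p (one q m)   = one q (merge-upper p m)
merge-upper p (two q m)   = two q (merge-upper p m)
merge-upper p (three q m) = three q (merge-upper p m)

merge-swap : ∀ {hi lo τ xs ys} → Merge hi lo τ xs ys → Merge hi lo (map swap12 τ) ys xs
merge-swap (done q)    = done q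
merge-swap (one q m)   = two q (merge-swap m)
merge-swap (two q m)   = one q (merge-swap m)
merge-swap (three q m) = three q (merge-swap m)

merge-< : ∀ {hi lo τ xs ys} → Merge hi lo τ xs ys → All (_< hi) ys
merge-< (done q)    = []
merge-< (one q m)   = merge-< m
merge-< (two q m)   = merge-bounds m ∷ merge-< m
merge-< (three q m) = merge-bounds m ∷ merge-< m

subsetOf : (n lo : ℕ) → List ℕ → Subset n
subsetOf zero    lo xs       = []
subsetOf (suc n) lo []       = outside ∷ subsetOf n (suc lo) []
subsetOf (suc n) lo (x ∷ xs) with lo ≟ x
... | yes _ = inside  ∷ subsetOf n (suc lo) xs
... | no  _ = outside ∷ subsetOf n (suc lo) (x ∷ xs)

subsetOf-hit : ∀ n lo xs → subsetOf (suc n) lo (lo ∷ xs) ≡ inside ∷ subsetOf n (suc lo) xs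
subsetOf-hit n lo xs with lo ≟ lo
... | yes _ = refl
... | no ¬p = contradiction refl ¬p

subsetOf-miss : ∀ n lo {x} xs → lo < x → subsetOf (suc n) lo (x ∷ xs) ≡ outside ∷ subsetOf n (suc lo) (x ∷ xs)
subsetOf-miss n lo {x} xs p with lo ≟ x
... | yes refl = contradiction p (n≮n lo)
... | no  _    = refl

subsetOf-skipʸ : ∀ n {hi lo l τ xs ys} → lo < l → Merge hi l τ xs ys →
                 subsetOf (suc n) lo ys ≡ outside ∷ subsetOf n (suc lo) ys
subsetOf-skipʸ n p (done _)    = refl
subsetOf-skipʸ n p (one q m)   = subsetOf-skipʸ n (≤-trans p (≤-trans q (n≤1+n _))) m
subsetOf-skipʸ n p (two q m)   = subsetOf-miss n _ _ (≤-trans p q)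
subsetOf-skipʸ n p (three q m) = subsetOf-miss n _ _ (≤-trans p q)

subsetOf-skipˣ : ∀ n {hi lo l τ xs ys} → lo < l → Merge hi l τ xs ys →
                 subsetOf (suc n) lo xs ≡ outside ∷ subsetOf n (suc lo) xs
subsetOf-skipˣ n p m = subsetOf-skipʸ n p (merge-swap m)

orderType-subsetOf : ∀ n {hi lo τ xs ys} → n + lo ≡ hi → Merge hi lo τ xs ys →
                     orderType (subsetOf n lo xs) (subsetOf n lo ys) ≡ τ
orderType-subsetOf zero e (done q) = refl
orderType-subsetOf zero refl (one q m)   = contradiction (merge-bounds m) (≤⇒≯ q)
orderType-subsetOf zero refl (two q m)   = contradiction (merge-bounds m) (≤⇒≯ q)
orderType-subsetOf zero refl (three q m) = contradiction (merge-bounds m) (≤⇒≯ q)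
orderType-subsetOf (suc n) {hi} {lo} {τ} {xs} {ys} e m = go m
  where
    e′ : n + suc lo ≡ hi
    e′ = trans (+-suc n lo) e
    skip : Merge hi (suc lo) τ xs ys → orderType (subsetOf (suc n) lo xs) (subsetOf (suc n) lo ys) ≡ τ
    skip m rewrite subsetOf-skipˣ n ≤-refl m | subsetOf-skipʸ n ≤-refl m = orderType-subsetOf n e′ m
    go : Merge hi lo τ xs ys → orderType (subsetOf (suc n) lo xs) (subsetOf (suc n) lo ys) ≡ τ
    go (done q) = skip (done (≤-trans (s≤s (m≤n+m lo n)) (≤-reflexive e)))
    go (one {p = p} {xs = xs} q m) with m≤n⇒m<n∨m≡n q
    ... | inj₁ lo<p = skip (one lo<p m)
    ... | inj₂ refl rewrite subsetOf-hit n lo xs | subsetOf-skipʸ n ≤-refl m =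
      cong (one ∷_) (orderType-subsetOf n e′ m)
    go (two {p = p} {ys = ys} q m) with m≤n⇒m<n∨m≡n q
    ... | inj₁ lo<p = skip (two lo<p m)
    ... | inj₂ refl rewrite subsetOf-hit n lo ys | subsetOf-skipˣ n ≤-refl m =
      cong (two ∷_) (orderType-subsetOf n e′ m)
    go (three {p = p} {xs = xs} {ys = ys} q m) with m≤n⇒m<n∨m≡n q
    ... | inj₁ lo<p = skip (three lo<p m)
    ... | inj₂ refl rewrite subsetOf-hit n lo xs | subsetOf-hit n lo ys =
      cong (three ∷_) (orderType-subsetOf n e′ m)

-- Realising a primary type by a set and its translate

Spaced : ℕ → ℕ → List ℕ → Set
Spaced D p []      = ⊤
Spaced D p (h ∷ q) = p + D ≤ h × Spaced D h q

spaced-weaken : ∀ {D D′ p} q → D′ ≤ D → Spaced D p q → Spaced D′ p q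
spaced-weaken []      D′≤D s       = tt
spaced-weaken (h ∷ q) D′≤D (a , s) = ≤-trans (+-monoʳ-≤ _ D′≤D) a , spaced-weaken q D′≤D s

spaced-snoc : ∀ {D p z} q → All (λ h → h + D ≤ z) q → p + D ≤ z → Spaced D p q → Spaced D p (q ++ z ∷ [])
spaced-snoc []      _        a _       = a , tt
spaced-snoc (h ∷ q) (b ∷ bs) a (c , s) = c , spaced-snoc q bs b s

spaced-advance : ∀ {D p} q → Spaced (D + D) p q → Spaced D (p + D) q
spaced-advance []      s = tt
spaced-advance {D} {p} (h ∷ q) (a , s) = ≤-trans (≤-reflexive (+-assoc p D D)) a , spaced-weaken q (m≤m+n D D) s

-- The last element placed so far is p, in the cnt-th cell of length K.  The queue q₁ ++ q₂ holds
-- the elements still due, namely z + K for placed z; those of q₁ are due in the current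
-- cell, those of q₂ in the next.  D is the free room kept around every one of these points.
record Queue (K cnt D slack p : ℕ) (q₁ q₂ : List ℕ) : Set where
  field
    room   : D ≤ K
    place  : p + D ≤ cnt * K
    spaced : Spaced D p (q₁ ++ q₂)
    recent : All (λ z → z + slack ≤ p + K) (q₁ ++ q₂)
    cell₁  : All (λ z → z + D ≤ cnt * K) q₁
    cell₂  : All (λ z → z + D ≤ suc cnt * K) q₂
open Queue

weaken-queue : ∀ {K cnt D D′ slack p q₁ q₂} → D′ ≤ D → Queue K cnt D slack p q₁ q₂ → Queue K cnt D′ 0 p q₁ q₂
weaken-queue {q₁ = q₁} {q₂} D′≤D Q = record
  { room   = ≤-trans D′≤D (room Q)
  ; place  = ≤-trans (+-monoʳ-≤ _ D′≤D) (place Q)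
  ; spaced = spaced-weaken (q₁ ++ q₂) D′≤D (spaced Q)
  ; recent = All.map (λ {z} a → ≤-trans (+-monoʳ-≤ z z≤n) a) (recent Q)
  ; cell₁  = All.map (λ {z} a → ≤-trans (+-monoʳ-≤ z D′≤D) a) (cell₁ Q)
  ; cell₂  = All.map (λ {z} a → ≤-trans (+-monoʳ-≤ z D′≤D) a) (cell₂ Q)
  }

halve-queue : ∀ {K cnt D p q₁ q₂} → Queue K cnt (D + D) (D + D) p q₁ q₂ → Queue K cnt D D p q₁ q₂
halve-queue {D = D} {q₁ = q₁} {q₂} Q = record
  { Queue (weaken-queue {D′ = D} (m≤m+n D D) Q) hiding (recent)
  ; recent = All.map (λ {z} a → ≤-trans (+-monoʳ-≤ z (m≤m+n D D)) a) (recent Q)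
  }

module _ {K cnt D p : ℕ} where

  later : ∀ {h z} → p + D ≤ h → z + 0 ≤ p + K → z + D ≤ h + K
  later {h} {z} p+D≤h a = begin
    z + D       ≤⟨ +-monoˡ-≤ D (≤-trans (m≤m+n z 0) a) ⟩
    p + K + D   ≡⟨ +-assoc p K D ⟩
    p + (K + D) ≡⟨ cong (p +_) (+-comm K D) ⟩
    p + (D + K) ≡⟨ +-assoc p D K ⟨
    p + D + K   ≤⟨ +-monoˡ-≤ K p+D≤h ⟩
    h + K ∎
    where open ≤-Reasoning

  advance : ∀ {q₁ q₂} → Queue K cnt (D + D) 0 p q₁ q₂ → Queue K cnt D D (p + D) q₁ q₂
  advance {q₁} {q₂} Q = record
    { Queue (weaken-queue {D′ = D} (m≤m+n D D) Q) using (room; cell₁; cell₂)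
    ; place  = ≤-trans (≤-reflexive (+-assoc p D D)) (place Q)
    ; spaced = spaced-advance (q₁ ++ q₂) (spaced Q)
    ; recent = All.map (later ≤-refl) (recent Q)
    }

  pop : ∀ {h q₁ q₂} → Queue K cnt D 0 p (h ∷ q₁) q₂ → Queue K cnt D D h q₁ q₂
  pop Q = record
    { room   = room Q
    ; place  = All.head (cell₁ Q)
    ; spaced = proj₂ (spaced Q)
    ; recent = All.map (later (proj₁ (spaced Q))) (All.tail (recent Q))
    ; cell₁  = All.tail (cell₁ Q)
    ; cell₂  = cell₂ Q
    }

  pop-block : ∀ {h q₂} → Queue K cnt D 0 p [] (h ∷ q₂) → Queue K (suc cnt) D D h q₂ []
  pop-block {h} {q₂} Q = record
    { room   = room Q
    ; place  = All.head (cell₂ Q)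
    ; spaced = subst (Spaced D h) (sym (++-identityʳ q₂)) (proj₂ (spaced Q))
    ; recent = All.map (later (proj₁ (spaced Q))) (++⁺ (All.tail (recent Q)) [])
    ; cell₁  = All.tail (cell₂ Q)
    ; cell₂  = []
    }

  -- With slack `D`, the field `recent` puts `p + K` at distance at least `D` beyond everything
  -- queued.
  enqueue : ∀ {q₁ q₂} → Queue K cnt D D p q₁ q₂ → Queue K cnt D 0 p q₁ (q₂ ++ p + K ∷ [])
  enqueue {q₁} {q₂} Q = record
    { room   = room Q
    ; place  = place Q
    ; spaced = subst (Spaced D p) (++-assoc q₁ q₂ _) (spaced-snoc (q₁ ++ q₂) (recent Q) (+-monoʳ-≤ p (room Q)) (spaced Q))
    ; recent = subst (All (λ z → z + 0 ≤ p + K)) (++-assoc q₁ q₂ _)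
        (++⁺ (All.map (λ {z} a → ≤-trans (+-monoʳ-≤ z z≤n) a) (recent Q)) (≤-reflexive (+-identityʳ (p + K)) ∷ []))
    ; cell₁  = cell₁ Q
    ; cell₂  = ++⁺ (cell₂ Q) (new ∷ [])
    }
    where
      open ≤-Reasoning
      new : p + K + D ≤ suc cnt * K
      new = begin
        p + K + D   ≡⟨ cong (_+ D) (+-comm p K) ⟩
        K + p + D   ≡⟨ +-assoc K p D ⟩
        K + (p + D) ≤⟨ +-monoʳ-≤ K (place Q) ⟩
        K + cnt * K ∎

length-snoc : ∀ {n} (q : List ℕ) z → length q ≡ n → length (q ++ z ∷ []) ≡ suc n
length-snoc q z refl = trans (length-++ q) (+-comm (length q) 1)

+2^ : ∀ n → 2 ^ n + 2 ^ n ≤ 2 ^ suc n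
+2^ n = ≤-reflexive (cong (2 ^ n +_) (sym (+-identityʳ (2 ^ n))))

-- A greedy placement from left to right: an entry 2 or 3 takes the head of the queue, an entry 1
-- goes into the free room after the last element, and every entry 1 or 3 queues its translate. The
-- lengths of `q₁` and `q₂` are the counters of `inBlock`, so a new cell is entered exactly when a
-- new block begins. Each entry 1 or 3 halves the room, which `2 ^ ones r` allows for.
realise-rest : ∀ K cnt need next q₁ q₂ p r → length q₁ ≡ need → length q₂ ≡ next → Run (need + next) r →
  Queue K cnt (2 ^ ones r) 0 p q₁ q₂ →
  ∃ λ xs → Merge (inBlock cnt need next r * K) (suc p) r xs (q₁ ++ q₂ ++ map (_+ K) xs)
realise-rest K cnt zero zero [] [] p [] e₁ e₂ done Q = [] , done (≤-trans (≤-reflexive (+-comm 1 p)) (place Q))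
realise-rest K cnt need next q₁ q₂ p (one ∷ r) e₁ e₂ R Q =
  p′ ∷ proj₁ rest ,
  one (≤-trans (≤-reflexive (+-comm 1 p)) (+-monoʳ-≤ p (m^n>0 2 (ones r))))
    (subst (Merge _ (suc p′) r (proj₁ rest)) (cong (q₁ ++_) (++-assoc q₂ _ _)) (proj₂ rest))
  where
    p′ = p + 2 ^ ones r
    up : ∀ {e} → Run e (one ∷ r) → Run (suc e) r
    up (one R) = R
    rest = realise-rest K cnt need (suc next) q₁ (q₂ ++ p′ + K ∷ []) p′ r e₁ (length-snoc q₂ _ e₂)
      (subst (λ e → Run e r) (sym (+-suc need next)) (up R))
      (enqueue (advance (weaken-queue (+2^ (ones r)) Q)))
realise-rest K cnt (suc need) next (h ∷ q₁) q₂ p (two ∷ r) e₁ e₂ (two R) Q =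
  let xs , m = realise-rest K cnt need next q₁ q₂ h r (suc-injective e₁) e₂ R (weaken-queue ≤-refl (pop Q)) in
  xs , two (≤-trans (≤-trans (≤-reflexive (+-comm 1 p)) (+-monoʳ-≤ p (m^n>0 2 (ones r)))) (proj₁ (spaced Q))) m
realise-rest K cnt zero (suc next) [] (h ∷ q₂) p (two ∷ r) e₁ e₂ (two R) Q =
  let xs , m = realise-rest K (suc cnt) next 0 q₂ [] h r (suc-injective e₂) refl
                 (subst (λ e → Run e r) (sym (+-identityʳ next)) R) (weaken-queue ≤-refl (pop-block Q)) in
  xs , two (≤-trans (≤-trans (≤-reflexive (+-comm 1 p)) (+-monoʳ-≤ p (m^n>0 2 (ones r)))) (proj₁ (spaced Q))) m
realise-rest K cnt (suc need) next (h ∷ q₁) q₂ p (three ∷ r) e₁ e₂ (three R) Q =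
  h ∷ proj₁ rest ,
  three (≤-trans (≤-trans (≤-reflexive (+-comm 1 p)) (+-monoʳ-≤ p (m^n>0 2 (suc (ones r))))) (proj₁ (spaced Q)))
    (subst (Merge _ (suc h) r (proj₁ rest)) (cong (q₁ ++_) (++-assoc q₂ _ _)) (proj₂ rest))
  where
    rest = realise-rest K cnt need (suc next) q₁ (q₂ ++ h + K ∷ []) h r (suc-injective e₁) (length-snoc q₂ _ e₂)
      (subst (λ e → Run e r) (sym (+-suc need next)) R)
      (enqueue (halve-queue (pop (weaken-queue (+2^ (ones r)) Q))))
realise-rest K cnt zero (suc next) [] (h ∷ q₂) p (three ∷ r) e₁ e₂ (three R) Q =
  let xs , m = realise-rest K (suc cnt) next 1 q₂ (h + K ∷ []) h r (suc-injective e₂) refl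
                 (subst (λ e → Run e r) (+-comm 1 next) R)
                 (enqueue (halve-queue (pop-block (weaken-queue (+2^ (ones r)) Q)))) in
  h ∷ xs , three (≤-trans (≤-trans (≤-reflexive (+-comm 1 p)) (+-monoʳ-≤ p (m^n>0 2 (suc (ones r))))) (proj₁ (spaced Q))) m

-- A set X with τ(X, X + K) = ρ such that X + K lies within b cells of length K.
record Template (ρ : Seq) (b : ℕ) : Set where
  field
    K     : ℕ
    K≢0   : NonZero K
    xs    : List ℕ
    merge : Merge (b * K) 0 ρ xs (map (_+ K) xs)

primary-template : ∀ {r} → Run 1 r → Template (one ∷ r) (primaryBlocks (one ∷ r))
primary-template {r} R = record
  { K = K ; K≢0 = m^n≢0 2 (suc (ones r)) ; xs = D ∷ proj₁ rest
  ; merge = one z≤n (subst (λ b → Merge (b * K) (suc D) r (proj₁ rest) (map (_+ K) (D ∷ proj₁ rest)))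
      (sym (firstBlock≡inBlock 1 r)) (proj₂ rest)) }
  where
    D = 2 ^ ones r
    K = 2 ^ suc (ones r)
    -- Nothing is placed yet: 0 stands for the left end of the first cell, whose midpoint `D`
    -- becomes the first element.
    start : Queue K 1 K 0 0 [] []
    start = record { room = ≤-refl ; place = ≤-reflexive (sym (*-identityˡ K)) ; spaced = tt
                   ; recent = [] ; cell₁ = [] ; cell₂ = [] }
    rest = realise-rest K 1 0 1 [] (D + K ∷ []) D r refl refl R
      (enqueue (advance (weaken-queue (+2^ (ones r)) start)))

-- Homomorphisms from shift graphs

Increasing : ℕ → (ℕ → ℕ) → Set
Increasing d w = ∀ {t} → t < d → w t < w (suc t)

increasing-< : ∀ {d w s t} → Increasing d w → s < t → t ≤ d → w s < w t
increasing-< {d} {w} {s} inc s<t t≤d = go (≤⇒≤′ s<t) t≤d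
  where
    go : ∀ {t} → suc s ≤′ t → t ≤ d → w s < w t
    go (≤′-reflexive refl) t≤d = inc t≤d
    go (≤′-step p)         t<d = <-trans (go p (<⇒≤ t<d)) (inc t<d)

increasing-≤ : ∀ {d w t} → Increasing d w → t ≤ d → w t ≤ w d
increasing-≤ {d} {w} {t} inc t≤d with m≤n⇒m<n∨m≡n t≤d
... | inj₁ t<d  = <⇒≤ (increasing-< inc t<d ≤-refl)
... | inj₂ refl = ≤-refl

-- Moves the t-th cell of length K onto the w t-th one.
relocate : ∀ K .{{_ : NonZero K}} → (ℕ → ℕ) → ℕ → ℕ
relocate K w v = w (v / K) * K + v % K

module _ (K : ℕ) .{{_ : NonZero K}} where

  relocate-< : ∀ {N w v} → w (v / K) < N → relocate K w v < N * K
  relocate-< {N} {w} {v} p = begin-strict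
    w (v / K) * K + v % K <⟨ +-monoʳ-< (w (v / K) * K) (m%n<n v K) ⟩
    w (v / K) * K + K     ≡⟨ +-comm (w (v / K) * K) K ⟩
    suc (w (v / K)) * K   ≤⟨ *-monoˡ-≤ K p ⟩
    N * K ∎
    where open ≤-Reasoning

  relocate-mono : ∀ {d w v v′} → Increasing d w → v < v′ → v′ < suc d * K → relocate K w v < relocate K w v′
  relocate-mono {d} {w} {v} {v′} inc v<v′ bnd with m≤n⇒m<n∨m≡n (/-monoˡ-≤ K (<⇒≤ v<v′))
  ... | inj₁ q = <-≤-trans (relocate-< {w = w} {v} (increasing-< inc q (s≤s⁻¹ (m<n*o⇒m/o<n bnd)))) (m≤m+n (w (v′ / K) * K) _)
  ... | inj₂ q rewrite q = +-monoʳ-< (w (v′ / K) * K) (+-cancelʳ-< (v′ / K * K) (v % K) (v′ % K)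
    (subst₂ _<_ (trans (m≡m%n+[m/n]*n v K) (cong (λ z → v % K + z * K) q)) (m≡m%n+[m/n]*n v′ K) v<v′))

  [m+K]/K≡1+m/K : ∀ m → (m + K) / K ≡ suc (m / K)
  [m+K]/K≡1+m/K m = trans (m/n≡1+[m∸n]/n (m≤n+m K m)) (cong (λ z → suc (z / K)) (m+n∸n≡m m K))

  -- Translation by one cell becomes the shift of the tuple; this is what makes a template a
  -- homomorphism.
  relocate-shift : ∀ w v → relocate K w (v + K) ≡ relocate K (w ∘ suc) v
  relocate-shift w v = cong₂ (λ a b → w a * K + b) ([m+K]/K≡1+m/K v) ([m+n]%n≡m%n v K)

module _ {ρ b} (T : Template ρ b) where
  open Template T
  private instance _ = K≢0

  -- The translate of `x` lies within `b` cells, so `x` lies within one fewer. Hence the relocated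
  -- set depends on the first `d` values of `w` only.
  template-cells : ∀ {d} → b ≤ suc d → All (λ x → x / K < d) xs
  template-cells b≤1+d = All.map
    (λ {x} p → s≤s⁻¹ (≤-trans (≤-reflexive (cong suc (sym ([m+K]/K≡1+m/K K x)))) (≤-trans (m<n*o⇒m/o<n p) b≤1+d)))
    (map⁻ (merge-< merge))

  relocate-template : ∀ {d N w} → b ≤ suc d → Increasing d w → w d < N →
    Merge (N * K) 0 ρ (map (relocate K w) xs) (map (relocate K (w ∘ suc)) xs)
  relocate-template {d} {N} {w} b≤1+d inc w<N = subst (Merge (N * K) 0 ρ _)
    (trans (sym (map-∘ xs)) (map-cong (relocate-shift K w) xs))
    (merge-map (relocate K w)
      (λ p q → relocate-mono K inc p (<-≤-trans q (*-monoˡ-≤ K b≤1+d)))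
      (λ {p} q → relocate-< K {w = w} {p} (≤-<-trans (increasing-≤ inc (s≤s⁻¹ (≤-trans (m<n*o⇒m/o<n q) b≤1+d))) w<N))
      z≤n (λ _ _ → z≤n) merge)

at : List ℕ → ℕ → ℕ
at []      t       = 0
at (x ∷ z) zero    = x
at (x ∷ z) (suc t) = at z t

at-applyUpTo : ∀ w {d t} → t < d → at (applyUpTo w d) t ≡ w t
at-applyUpTo w {suc d} {zero}  _       = refl
at-applyUpTo w {suc d} {suc t} (s≤s p) = at-applyUpTo (w ∘ suc) p

-- Homomorphisms from the shift graph of d-element subsets of [N] to G(hi, τ).
record ShiftHom (d N hi : ℕ) (τ : Seq) : Set where
  field
    vertex : List ℕ → List ℕ
    edge   : ∀ w → Increasing d w → w d < N →
             Merge hi 0 τ (vertex (applyUpTo w d)) (vertex (applyUpTo (w ∘ suc) d))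

data Factor : Seq → Set where
  trivial   : Factor (three ∷ [])
  primary   : ∀ {r} → Run 1 r → Factor (one ∷ r)
  secondary : ∀ {r} → Run 1 (map swap12 r) → Factor (two ∷ r)

primary-hom : ∀ {ρ b} (T : Template ρ b) d N → b ≤ suc d → ShiftHom d N (N * Template.K T) ρ
primary-hom {ρ} T d N b≤1+d = record
  { vertex = vertex
  ; edge   = λ w inc w<N → subst₂ (Merge (N * K) 0 ρ) (vertex-applyUpTo w) (vertex-applyUpTo (w ∘ suc))
      (relocate-template T b≤1+d inc w<N) }
  where
    open Template T
    instance _ = K≢0
    vertex : List ℕ → List ℕ
    vertex z = map (relocate K (at z)) xs
    vertex-applyUpTo : ∀ w → map (relocate K w) xs ≡ vertex (applyUpTo w d)
    vertex-applyUpTo w = map-cong-local (All.map (λ {x} p → cong (λ a → a * K + x % K) (sym (at-applyUpTo w p)))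
      (template-cells T b≤1+d))

-- Reversing the tuples reverses the arcs of the shift graph.
secondary-hom : ∀ {ρ b} (T : Template (map swap12 ρ) b) d N → b ≤ suc d → ShiftHom d N (N * Template.K T) ρ
secondary-hom {ρ} T d N b≤1+d = record
  { vertex = vertex
  ; edge   = λ w inc w<N →
      subst₂ (Merge (N * K) 0 ρ) (first w) (second w)
        (subst (λ ρ → Merge (N * K) 0 ρ _ _) (swap-involutive ρ)
          (merge-swap (relocate-template T b≤1+d (reverse-increasing inc w<N) (reverse-< w inc w<N)))) }
  where
    open Template T
    instance _ = K≢0
    reverse : (ℕ → ℕ) → ℕ → ℕ
    reverse w t = N ∸ suc (w (d ∸ t))
    vertex : List ℕ → List ℕ
    -- Complementing in `N` restores the increasing order. The tuple of `w` yields `reverse w ∘ suc`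
    -- and that of `w ∘ suc` yields `reverse w`.
    vertex z = map (relocate K (λ t → N ∸ suc (at z (d ∸ suc t)))) xs
    reverse-< : ∀ w → Increasing d w → w d < N → reverse w d < N
    reverse-< w inc p = ∸-monoʳ-< {o = 0} (s≤s z≤n) (≤-trans (s≤s (increasing-≤ inc (m∸n≤m d d))) p)
    reverse-increasing : ∀ {w} → Increasing d w → w d < N → Increasing d (reverse w)
    reverse-increasing {w} inc p {t} t<d = ∸-monoʳ-<
      (s≤s (subst (λ s → w (d ∸ suc t) < w s) (sym (+-∸-assoc 1 t<d)) (inc (∸-monoʳ-< {o = 0} (s≤s z≤n) t<d))))
      (≤-trans (s≤s (increasing-≤ inc (m∸n≤m d t))) p)
    first : ∀ w → map (relocate K (reverse w ∘ suc)) xs ≡ vertex (applyUpTo w d)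
    first w = map-cong-local (All.map
      (λ {x} p → cong (λ a → (N ∸ suc a) * K + x % K) (sym (at-applyUpTo w (∸-monoʳ-< {o = 0} (s≤s z≤n) p))))
      (template-cells T b≤1+d))
    second : ∀ w → map (relocate K (reverse w)) xs ≡ vertex (applyUpTo (w ∘ suc) d)
    second w = map-cong-local (All.map
      (λ {x} p → cong (λ a → (N ∸ suc a) * K + x % K)
        (sym (trans (at-applyUpTo (w ∘ suc) (∸-monoʳ-< {o = 0} (s≤s z≤n) p)) (cong w (sym (+-∸-assoc 1 p))))))
      (template-cells T b≤1+d))

-- The translate of the first element lies beyond the first cell.
first-block-not-last : ∀ {r b} → Template (one ∷ r) b → 2 ≤ b
first-block-not-last {b = b} record { K = K ; merge = one {p = p} _ m } with merge-< m
... | p+K<b*K ∷ _ = ≰⇒> λ b≤1 → <⇒≱ p+K<b*K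
  (≤-trans (*-monoˡ-≤ K b≤1) (≤-trans (≤-reflexive (*-identityˡ K)) (m≤n+m K p)))

numBlocks≥2 : ∀ {ρ} → Factor ρ → ρ ≡ three ∷ [] ⊎ 2 ≤ numBlocks ρ
numBlocks≥2 trivial       = inj₁ refl
numBlocks≥2 (primary R)   = inj₂ (first-block-not-last (primary-template R))
numBlocks≥2 (secondary R) = inj₂ (first-block-not-last (primary-template R))

factor-hom : ∀ {ρ d} → Factor ρ → numBlocks ρ ≤ suc d → ∃ λ K → ∀ N → ShiftHom d N (N * K) ρ
factor-hom trivial       p = 1 , λ N → record
  -- The type 3 relates a set to itself, so a constant map is a homomorphism.
  { vertex = λ _ → 0 ∷ []
  ; edge   = λ w inc w<N → three z≤n (done (≤-trans (≤-<-trans z≤n w<N) (≤-reflexive (sym (*-identityʳ N))))) }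
factor-hom (primary R)   p = _ , λ N → primary-hom (primary-template R) _ N p
factor-hom (secondary R) p = _ , λ N → secondary-hom (primary-template R) _ N p

++-hom : ∀ {d N hi hi′ τ τ′} → ShiftHom d N hi τ → ShiftHom d N hi′ τ′ → ShiftHom d N (hi + hi′) (τ ++ τ′)
++-hom {hi = hi} F G = record
  { vertex = λ z → F.vertex z ++ map (hi +_) (G.vertex z)
  ; edge   = λ w inc w<N → merge-++ (F.edge w inc w<N)
      (merge-map (hi +_) (λ p _ → +-monoʳ-< hi p) (+-monoʳ-< hi) (m≤m+n hi _) (λ _ _ → m≤m+n hi _) (G.edge w inc w<N)) }
  where
    module F = ShiftHom F
    module G = ShiftHom G

concat-hom : ∀ {d ρs} → All Factor ρs → All (λ ρ → numBlocks ρ ≤ suc d) ρs →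
             ∃ λ K → ∀ N → ShiftHom d N (N * K) (concat ρs)
concat-hom []       []       = 0 , λ N → record { vertex = λ _ → [] ; edge = λ _ _ _ → done z≤n }
concat-hom {d} {ρ ∷ ρs} (f ∷ fs) (p ∷ ps) =
  let K , F = factor-hom f p
      L , G = concat-hom fs ps
  in K + L , λ N → subst (λ hi → ShiftHom d N hi (ρ ++ concat ρs)) (sym (*-distribˡ-+ N K L)) (++-hom (F N) (G N))

-- Colourings of shift graphs and their pullbacks

-- The colours of a d-subset z are the sets of colours of v ∷ z for v below z.
shift-graph-bound : ∀ d {m N} (c : List ℕ → Fin m) →
  (∀ w → Increasing (suc d) w → w (suc d) < N → c (applyUpTo w (suc d)) ≢ c (applyUpTo (w ∘ suc) (suc d))) →
  logIter d N ≤ m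
shift-graph-bound zero {m} {N} c proper = injective⇒≤ {f = λ v → c (toℕ v ∷ [])} inj
  where
    differ : ∀ {a b} → a < b → b < N → c (a ∷ []) ≢ c (b ∷ [])
    differ {a} {b} a<b = proper (λ { zero → a ; (suc _) → b }) λ { (s≤s z≤n) → a<b }
    inj : ∀ {u v : Fin N} → c (toℕ u ∷ []) ≡ c (toℕ v ∷ []) → u ≡ v
    inj {u} {v} e with <-cmp (toℕ u) (toℕ v)
    ... | tri< u<v _ _ = contradiction e (differ u<v (toℕ<n v))
    ... | tri≈ _ u≡v _ = toℕ-injective u≡v
    ... | tri> _ _ v<u = contradiction (sym e) (differ v<u (toℕ<n u))
shift-graph-bound (suc d) {m} {N} c proper = n≤2^k⇒⌊log₂n⌋≤k (shift-graph-bound d {2 ^ m} c′ proper′)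
  where
    Below : List ℕ → Fin m → Fin N → Set
    Below z a v = toℕ v < at z 0 × c (toℕ v ∷ z) ≡ a
    below? : ∀ z a → Dec (∃ (Below z a))
    below? z a = any? λ v → (toℕ v <? at z 0) ×-dec (c (toℕ v ∷ z) Fin.≟ a)
    c′ : List ℕ → Fin (2 ^ m)
    c′ z = funToFin {m} {2} (λ a → bit (below? z a))
    proper′ : ∀ w → Increasing (suc d) w → w (suc d) < N → c′ (applyUpTo w (suc d)) ≢ c′ (applyUpTo (w ∘ suc) (suc d))
    proper′ w inc w<N e =
      -- The colour `a` of the whole tuple occurs below its tail, through `w 0`. If the codes agree,
      -- it also occurs below the initial part, through some `v` below `w 0`. Then `v` followed by
      -- the tuple gives two adjacent vertices of colour `a`.
      let a = c (applyUpTo w (suc (suc d)))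
          w₀<N = ≤-<-trans (increasing-≤ inc z≤n) w<N
          hit : ∃ (Below (applyUpTo (w ∘ suc) (suc d)) a)
          hit = fromℕ< w₀<N , subst (_< w 1) (sym (toℕ-fromℕ< w₀<N)) (inc (s≤s z≤n)) ,
                cong (λ v → c (v ∷ applyUpTo (w ∘ suc) (suc d))) (toℕ-fromℕ< w₀<N)
          v , v<w₀ , same = bit-transfer (below? _ a) (below? (applyUpTo w (suc d)) a) (funToFin-injective (sym e) a) hit
      in proper (λ { zero → toℕ v ; (suc t) → w t })
           (λ { {zero} _ → v<w₀ ; {suc t} (s≤s p) → inc p }) w<N same

module _ {τ d N hi n} (F : ShiftHom d N hi τ) (hi≤n : hi ≤ n) (balanced : ones τ ≡ twos τ) where
  open ShiftHom F

  subset : List ℕ → Subset n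
  subset z = subsetOf n 0 (vertex z)

  subset-orderType : ∀ w → Increasing d w → w d < N →
                     orderType (subset (applyUpTo w d)) (subset (applyUpTo (w ∘ suc) d)) ≡ τ
  subset-orderType w inc w<N = orderType-subsetOf n (+-identityʳ n) (merge-upper hi≤n (edge w inc w<N))

  pullback : ∀ {m} → d < N → Colourable τ n m → Σ (List ℕ → Fin m) λ c →
    ∀ w → Increasing d w → w d < N → c (applyUpTo w d) ≢ c (applyUpTo (w ∘ suc) d)
  pullback {m} d<N (col , proper) = c , c-proper
    where
      card : ∀ w → Increasing d w → w d < N → ∣ subset (applyUpTo w d) ∣ ≡ ones τ × ∣ subset (applyUpTo (w ∘ suc) d) ∣ ≡ ones τ
      card w inc w<N =
        let e = subset-orderType w inc w<N in
        trans (sym (ones-orderType (subset (applyUpTo w d)) _)) (cong ones e) ,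
        trans (sym (twos-orderType (subset (applyUpTo w d)) _)) (trans (cong twos e) (sym balanced))
      colourOf : (X : Subset n) → Dec (∣ X ∣ ≡ ones τ) → Fin m
      colourOf X (yes p) = col (X , p)
      -- Sets of the wrong size do not occur on the edges considered. They receive the colour of
      -- some vertex, which exists since `d < N`.
      colourOf X (no  _) = col (subset (applyUpTo id d) , proj₁ (card id (λ _ → ≤-refl) d<N))
      c : List ℕ → Fin m
      c z = colourOf (subset z) (∣ subset z ∣ ≟ ones τ)
      c-proper : ∀ w → Increasing d w → w d < N → c (applyUpTo w d) ≢ c (applyUpTo (w ∘ suc) d)
      c-proper w inc w<N with ∣ subset (applyUpTo w d) ∣ ≟ ones τ | ∣ subset (applyUpTo (w ∘ suc) d) ∣ ≟ ones τ
      ... | yes p | yes q = proper _ _ (inj₁ (subset-orderType w inc w<N))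
      ... | no ¬p | _     = contradiction (proj₁ (card w inc w<N)) ¬p
      ... | yes _ | no ¬q = contradiction (proj₂ (card w inc w<N)) ¬q

colourable-bound : ∀ {τ d} → ones τ ≡ twos τ → (∃ λ K → ∀ N → ShiftHom (suc d) N (N * K) τ) →
  ∃ λ a → ∃ λ N → ∀ n → N ≤ n → ∀ m → Colourable τ n m → logIter d n ≤ a * m
colourable-bound {τ} {d} balanced (K , F) =
  -- With `N` the quotient of `n` by `suc K`, a nonzero divisor, `n ≤ 2 * suc K * N` holds as soon
  -- as `N` is positive.
  let a , N₀ , h = logIter-multiple d (2 * suc K) in
  -- This threshold makes `N` at least `N₀`, for the comparison of logarithms, and larger than
  -- `suc d`, for the pullback.
  a , (N₀ + suc (suc d)) * suc K , λ n big m col →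
    let N = n / suc K
        N-big : N₀ + suc (suc d) ≤ N
        N-big = ≤-trans (≤-reflexive (sym (m*n/n≡m _ (suc K)))) (/-monoˡ-≤ (suc K) big)
        c , proper = pullback (F N) (≤-trans (*-monoʳ-≤ N (n≤1+n K)) (m/n*n≤m n (suc K))) balanced
                       (≤-trans (m≤n+m (suc (suc d)) N₀) N-big) col
    in ≤-trans (h n N (≤-trans (m≤m+n N₀ _) N-big) (n≤2[1+K][n/[1+K]] n (≤-trans (≤-trans (s≤s z≤n) (m≤n+m (suc (suc d)) N₀)) N-big)))
         (*-monoʳ-≤ a (shift-graph-bound d c proper))
  where
    n≤2[1+K][n/[1+K]] : ∀ n → 1 ≤ n / suc K → n ≤ 2 * suc K * (n / suc K)
    n≤2[1+K][n/[1+K]] n 1≤N = begin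
      n                                  ≡⟨ m≡m%n+[m/n]*n n (suc K) ⟩
      n % suc K + N * suc K              ≤⟨ +-monoˡ-≤ _ (≤-trans (m%n≤n n (suc K)) (≤-trans (≤-reflexive (sym (*-identityˡ _))) (*-monoˡ-≤ (suc K) 1≤N))) ⟩
      N * suc K + N * suc K              ≡⟨ cong (N * suc K +_) (+-identityʳ _) ⟨
      2 * (N * suc K)                    ≡⟨ cong (2 *_) (*-comm N (suc K)) ⟩
      2 * (suc K * N)                    ≡⟨ *-assoc 2 (suc K) N ⟨
      2 * suc K * N ∎
      where
        open ≤-Reasoning
        N = n / suc K

-- Factorisations into irreducible types

isType⇒balanced : ∀ {τ} → IsType τ → ones τ ≡ twos τ
isType⇒balanced (_ , X , Y , e , refl) = trans (ones-orderType X Y) (trans e (sym (twos-orderType X Y)))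

realise : ∀ τ → Σ (Subset (length τ)) λ X → Σ (Subset (length τ)) λ Y → orderType X Y ≡ τ
realise [] = [] , [] , refl
realise (one   ∷ τ) = let X , Y , e = realise τ in inside  ∷ X , outside ∷ Y , cong (one ∷_) e
realise (two   ∷ τ) = let X , Y , e = realise τ in outside ∷ X , inside  ∷ Y , cong (two ∷_) e
realise (three ∷ τ) = let X , Y , e = realise τ in inside  ∷ X , inside  ∷ Y , cong (three ∷_) e

balanced⇒isType : ∀ τ → ones τ ≡ twos τ → IsType τ
balanced⇒isType τ e = let X , Y , f = realise τ in
  length τ , X , Y ,
  trans (sym (trans (cong ones (sym f)) (ones-orderType X Y))) (trans e (trans (cong twos (sym f)) (twos-orderType X Y))) , f

balanced-++ʳ : ∀ A B → ones (A ++ B) ≡ twos (A ++ B) → ones A ≡ twos A → ones B ≡ twos B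
balanced-++ʳ A B e f = +-cancelˡ-≡ (twos A) _ _
  (trans (cong (_+ ones B) (sym f)) (trans (sym (ones-++ A B)) (trans e (twos-++ A B))))

-- By hypothesis no proper prefix brings the walk to height 0, so every entry is read at positive
-- height; the balance makes the walk end at 0.
run : ∀ e r → (∀ A B → A ++ B ≡ r → NonEmpty B → e + ones A ≢ twos A) → e + ones r ≡ twos r → Run e r
run zero    []          h b = done
run zero    (x ∷ r)     h b = contradiction refl (h [] (x ∷ r) refl (λ ()))
run (suc e) (one ∷ r)   h b = one (run (suc (suc e)) r
  (λ A B eq ne p → h (one ∷ A) B (cong (one ∷_) eq) ne (trans (cong suc (+-suc e (ones A))) p))
  (trans (sym (cong suc (+-suc e (ones r)))) b))
run (suc e) (two ∷ r)   h b = two (run e r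
  (λ A B eq ne p → h (two ∷ A) B (cong (two ∷_) eq) ne (cong suc p)) (suc-injective b))
run (suc e) (three ∷ r) h b = three (run (suc e) r
  (λ A B eq ne p → h (three ∷ A) B (cong (three ∷_) eq) ne (cong suc (trans (+-suc e (ones A)) p)))
  (trans (sym (+-suc e (ones r))) (suc-injective b)))

irreducible⇒no-balanced-prefix : ∀ {ρ} → Irreducible ρ → ∀ A B → A ++ B ≡ ρ → NonEmpty A → NonEmpty B →
                                 ones A ≢ twos A
irreducible⇒no-balanced-prefix (isT , _ , irr) A B refl neA neB b =
  irr A B (balanced⇒isType A b) (balanced⇒isType B (balanced-++ʳ A B (isType⇒balanced isT) b)) neA neB refl

irreducible⇒factor : ∀ {ρ} → Irreducible ρ → Factor ρ
irreducible⇒factor {[]} (_ , ne , _) = contradiction refl ne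
irreducible⇒factor {one ∷ r} irr@(isT , _) = primary (run 1 r
  (λ A B eq ne → irreducible⇒no-balanced-prefix irr (one ∷ A) B (cong (one ∷_) eq) (λ ()) ne)
  (isType⇒balanced isT))
irreducible⇒factor {two ∷ r} irr@(isT , _) = secondary (run 1 (map swap12 r)
  (λ A B eq ne p → irreducible⇒no-balanced-prefix irr (two ∷ map swap12 A) (map swap12 B)
    (cong (two ∷_) (trans (sym (map-++ swap12 A B)) (trans (cong (map swap12) eq) (swap-involutive r))))
    (λ ()) (λ { e → ne (trans (sym (swap-involutive B)) (cong (map swap12) e)) })
    (trans (ones-swap A) (trans (sym p) (cong suc (sym (twos-swap A))))))
  (trans (cong suc (ones-swap r)) (trans (sym (isType⇒balanced isT)) (sym (twos-swap r)))))
irreducible⇒factor {three ∷ []} _ = trivial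
irreducible⇒factor {three ∷ x ∷ r} irr =
  contradiction refl (irreducible⇒no-balanced-prefix irr (three ∷ []) (x ∷ r) refl (λ ()) (λ ()))

irreducibles-balanced : ∀ {ρs} → All Irreducible ρs → ones (concat ρs) ≡ twos (concat ρs)
irreducibles-balanced [] = refl
irreducibles-balanced {ρ ∷ ρs} ((isT , _) ∷ irrs) = trans (ones-++ ρ (concat ρs))
  (trans (cong₂ _+_ (isType⇒balanced isT) (irreducibles-balanced irrs)) (sym (twos-++ ρ (concat ρs))))

-- The factor with the most blocks

≤-maximum : ∀ {ρs b} → maximum (map numBlocks ρs) ≤ b → All (λ ρ → numBlocks ρ ≤ b) ρs
≤-maximum {[]}     p = []
≤-maximum {ρ ∷ ρs} p = m⊔n≤o⇒m≤o (numBlocks ρ) _ p ∷ ≤-maximum (m⊔n≤o⇒n≤o (numBlocks ρ) _ p)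

maximum-attained : ∀ ρs {b} → maximum (map numBlocks ρs) ≡ suc b →
                   ∃ λ P → ∃ λ ρ → ∃ λ S → ρs ≡ P ++ ρ ∷ S × numBlocks ρ ≡ suc b
maximum-attained (ρ ∷ ρs) e with ⊔-sel (numBlocks ρ) (maximum (map numBlocks ρs))
... | inj₁ p = [] , ρ , ρs , refl , trans (sym p) e
... | inj₂ p with maximum-attained ρs (trans (sym p) e)
...   | P , σ , S , refl , q = ρ ∷ P , σ , S , refl , q

maximum≥2 : ∀ {ρs} → All Factor ρs → Trivial (concat ρs) ⊎ 2 ≤ maximum (map numBlocks ρs)
maximum≥2 [] = inj₁ []
maximum≥2 {ρ ∷ ρs} (f ∷ fs) with numBlocks≥2 f | maximum≥2 fs
... | inj₁ refl | inj₁ triv = inj₁ (refl ∷ triv)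
... | inj₂ p    | _         = inj₂ (≤-trans p (m≤m⊔n (numBlocks ρ) _))
... | inj₁ _    | inj₂ p    = inj₂ (≤-trans p (m≤n⊔m (numBlocks ρ) _))

factor-colouring : ∀ {P ρ S c} → Factor ρ → numBlocks ρ ≡ suc (suc c) → ones P ≡ twos P → FactorColouring (P ++ ρ ++ S) c
factor-colouring trivial       ()
factor-colouring (primary R)   e b = primary-colouring R e b
factor-colouring (secondary R) e b = secondary-colouring R e b

concat-colouring : ∀ {ρs c} → All Irreducible ρs → maximum (map numBlocks ρs) ≡ suc (suc c) → FactorColouring (concat ρs) c
concat-colouring {ρs} {c} irrs e with maximum-attained ρs e
... | P , ρ , S , refl , blocks = subst (λ τ → FactorColouring τ c) (concat-++ P (ρ ∷ S))
  (factor-colouring {concat P} {ρ} {concat S} (irreducible⇒factor (All.head (++⁻ʳ P irrs))) blocks (irreducibles-balanced (++⁻ˡ P irrs)))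

theorem1p8 : (τ : Seq) → IsType τ → Nontrivial τ →
    (ρs : List Seq) → All Irreducible ρs → concat ρs ≡ τ →
    Σ ℕ λ a → Σ ℕ λ b → Σ ℕ λ N → (n : ℕ) → N ≤ n →
    Colourable τ n (b * logIter (maximum (map numBlocks ρs) ∸ 2) n) ×
    ((m : ℕ) → Colourable τ n m → logIter (maximum (map numBlocks ρs) ∸ 2) n ≤ a * m)
theorem1p8 .(concat ρs) isT nontrivial ρs irrs refl
  -- A nontrivial type has a factor with at least two blocks, so the subtraction of 2 is exact.
  with maximum (map numBlocks ρs) in e | maximum≥2 (All.map irreducible⇒factor irrs)
... | _           | inj₁ triv = contradiction triv nontrivial
... | suc zero    | inj₂ (s≤s ())
... | suc (suc c) | inj₂ _    =
  let b , N , upper  = colourable (concat-colouring irrs e)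
      a , N′ , lower = colourable-bound (isType⇒balanced isT)
                         (concat-hom (All.map irreducible⇒factor irrs) (≤-maximum (≤-reflexive e)))
  in a , b , N ⊔ N′ , λ n p →
     (let _ , m≤ , col = upper n (m⊔n≤o⇒m≤o N N′ p) in Colourable-mono m≤ col) ,
     lower n (m⊔n≤o⇒n≤o N N′ p)
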